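{- Let $n$ be a positive integer and let $k,l$ be relatively prime positive integers with $k\le n$ and $l\le n$. Then for all nonnegative integers $i,j$, $$m_n^{k,l}(i,j)=\frac{n!}{kl}.$$
   Context: $S_n$ is the symmetric group on $[n]=\{1,\dots,n\}$. For $\pi=a_1a_2\cdots a_n\in S_n$ (one-line notation), the major index is $\mathrm{maj}\,\pi=\sum_{a_i>a_{i+1}} i$. For positive integers $k,l$ and nonnegative integers $i,j$, define $m_n^{k,l}(i,j)=\#\{\pi\in S_n:\ \mathrm{maj}\,\pi\equiv i \pmod k \text{ and } \mathrm{maj}\,\pi^{ -1}\equiv j\pmod l\}$. -}

module Defs where

open import Data.Nat using (ℕ; zero; suc; _+_; _*_; _<ᵇ_; _%_; NonZero)
open import Data.Fin using (Fin; toℕ; _≟_)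
import Data.Fin as F
open import Data.Vec using (Vec; []; _∷_; lookup; tabulate; toList)
open import Data.List using (List; []; _∷_; length; filter; concatMap; map; allFin)
open import Data.List.Relation.Unary.Unique.Propositional using (Unique)
open import Data.List.Relation.Unary.Unique.DecPropositional using (unique?)
open import Data.Maybe using (Maybe; just; nothing)
open import Data.Bool using (Bool; if_then_else_)
open import Relation.Nullary using (does)
open import Relation.Binary.PropositionalEquality using (_≡_)
open import Relation.Nullary.Decidable using (_×-dec_)

words : (m n : ℕ) → List (Vec (Fin n) m)
words zero    n = [] ∷ []
words (suc m) n = concatMap (λ a → map (a ∷_) (words m n)) (allFin n)

-- S_n in one-line notation: the words of length n over Fin n with distinct letters.
-- (Letters are 0-based: Fin n stands for [n] via x ↦ toℕ x + 1.)
Sym : (n : ℕ) → List (Vec (Fin n) n)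
Sym n = filter (λ v → unique? _≟_ (toList v)) (words n n)

majFrom : ∀ {n m} → ℕ → Vec (Fin n) m → ℕ
majFrom i []              = 0
majFrom i (a ∷ [])        = 0
majFrom i (a ∷ b ∷ rest)  =
  (if toℕ b <ᵇ toℕ a then i else 0) + majFrom (suc i) (b ∷ rest)

maj : ∀ {n m} → Vec (Fin n) m → ℕ
maj = majFrom 1

positionOf : ∀ {n m} → Fin n → Vec (Fin n) m → Maybe (Fin m)
positionOf x []       = nothing
positionOf x (a ∷ v) with does (a ≟ x)
... | Data.Bool.true  = just F.zero
... | Data.Bool.false = Data.Maybe.map F.suc (positionOf x v)

-- inverse of a permutation in one-line notation: π⁻¹(x) = position of x in π.
-- (The fallback branch never occurs when v is a permutation.)
inverse : ∀ {n} → Vec (Fin n) n → Vec (Fin n) n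
inverse v = tabulate (λ x → fallback x (positionOf x v))
  where
  fallback : ∀ {n} → Fin n → Maybe (Fin n) → Fin n
  fallback x (just p) = p
  fallback x nothing  = x

count : (n k l i j : ℕ) → .{{NonZero k}} → .{{NonZero l}} → ℕ
count n k l i j =
  length (filter (λ π → ((maj π % k) Data.Nat.≟ (i % k)) ×-dec ((maj (inverse π) % l) Data.Nat.≟ (j % l))) (Sym n))

{-# OPTIONS --safe #-}
module Submission where

-- Read A_n(p, q) = Σ_{π ∈ S_n} p^{maj π} q^{maj π⁻¹} as the functional f ↦ Σ_π f (maj π) (maj π⁻¹)
-- on test functions f, so that working modulo q^a - 1 means restricting to f that are a-periodic in
-- the second argument. A permutation of [a + b] is a shuffle of a permutation u of the small letters
-- with a permutation v of the large ones; modulo a, maj π⁻¹ is maj u⁻¹ + maj v⁻¹, and by the shuffle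
-- theorem maj is distributed over the shuffles as p^{maj u + maj v} [a + b choose a]_p. Hence
-- A_{a+b} = [a + b choose a]_p A_a A_b modulo q^a - 1, and symmetrically under π ↦ π⁻¹.
-- For k < l this reduces A_n first to A_l, modulo q^l - 1, and then to [l choose k]_q A_k A_{l-k},
-- modulo p^k - 1. The two Pascal rules show that [a + b choose a]_q is fixed by multiplication with
-- q^a modulo q^{a+b} - 1, so for coprime k and l the factor [l choose k]_q is uniform on ℤ/l; the
-- same fact for [k choose 1] makes A_k uniform on ℤ/k.

open import Defs
open import Data.Bool using (Bool; true; false; if_then_else_; _∧_)
open import Data.Bool.Properties using (T-≡; ¬-not)
open import Data.Empty using (⊥-elim)
open import Data.Fin as Fin using (Fin; zero; suc; toℕ; punchOut)
import Data.Fin.Properties as Fin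
open import Data.List as List using (List; []; _∷_; [_]; _++_; _ʳ++_; map; concatMap; length; upTo; applyUpTo; allFin; reverse; filter)
open import Data.List.Membership.Propositional using (_∈_; _∉_; find; lose)
open import Data.List.Membership.Propositional.Properties using (∈-map⁺; ∈-map⁻; ∈-++⁻; ∈-concatMap⁺; ∈-concatMap⁻; ∈-∃++; ∈-allFin; ∈-filter⁺; ∈-filter⁻; ∈-upTo⁻)
open import Data.List.Membership.Propositional.Properties.WithK using (unique∧set⇒bag)
open import Data.List.Properties using (length-++; length-map; length-tabulate; length-upTo; map-∘; map-++; map-id; map-tabulate; map-upTo; reverse-injective; reverse-involutive; reverse-map; ∷-injectiveˡ; ∷-injectiveʳ)
open import Data.List.Relation.Binary.BagAndSetEquality using (∼bag⇒↭)
open import Data.List.Relation.Binary.Disjoint.Propositional using (Disjoint)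
open import Data.List.Relation.Binary.Permutation.Propositional using (_↭_; prep; swap; ↭-refl; ↭-sym; ↭-trans; ↭⇒↭ₛ)
open import Data.List.Relation.Binary.Permutation.Propositional.Properties using (↭-length; ↭-reverse; All-resp-↭; ∈-resp-↭; drop-mid)
import Data.List.Relation.Binary.Permutation.Setoid.Properties as Permutationₛ
import Data.List.Relation.Binary.Sublist.Heterogeneous as Heterogeneous
import Data.List.Relation.Binary.Sublist.Heterogeneous.Properties as Heterogeneous
open import Data.List.Relation.Binary.Sublist.Propositional using (_⊆_; []; _∷_; _∷ʳ_; ⊆-trans; to∈; from∈)
import Data.List.Relation.Binary.Sublist.Propositional.Properties as Sublist
open import Data.List.Relation.Ternary.Interleaving.Propositional as Interleaving using (Interleaving; []; consˡ; consʳ; toPermutation)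
open import Data.List.Relation.Unary.All as All using (All; []; _∷_)
import Data.List.Relation.Unary.All.Properties as All
open import Data.List.Relation.Unary.AllPairs using (AllPairs; []; _∷_)
import Data.List.Relation.Unary.AllPairs.Properties as AllPairs
open import Data.List.Relation.Unary.Any using (here; there)
open import Data.List.Relation.Unary.Unique.DecPropositional using (unique?)
open import Data.List.Relation.Unary.Unique.Propositional using (Unique)
import Data.List.Relation.Unary.Unique.Propositional.Properties as Unique
open import Data.Maybe using (just)
open import Data.Nat using (ℕ; zero; suc; _+_; _*_; _<ᵇ_; _≡ᵇ_; _<_; _≤_; z<s; s<s; _%_; NonZero; _!)
open import Data.Nat.Coprimality as Coprimality using (Coprime; coprime-Bézout; gcd≡1⇒coprime)
open import Data.Nat.Divisibility using (∣-refl)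
open import Data.Nat.DivMod using (m%n<n; m<n⇒m%n≡m; [m+n]%n≡m%n)
open import Data.Nat.GCD using (gcd; module Bézout)
open import Data.Nat.Properties
open import Data.List.Relation.Binary.Sublist.DecPropositional _≟_ using (_⊆?_)
open import Data.Nat.Tactic.RingSolver using (solve-∀)
open import Data.Product using (Σ; _×_; _,_; proj₁; proj₂; ∃-syntax)
open import Data.Sum using (inj₁; inj₂)
open import Data.Vec as Vec using (Vec; []; _∷_; toList; lookup; tabulate)
import Data.Vec.Properties as Vec
open import Function using (_∘_; id; flip; Equivalence; mk⇔)
open import Level using (Level)
open import Relation.Binary.Definitions using (tri<; tri≈; tri>)
open import Relation.Binary.PropositionalEquality using (_≡_; _≢_; refl; sym; trans; cong; cong₂; subst; subst₂; setoid; module ≡-Reasoning)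
open import Relation.Nullary using (¬_; does; yes; no)
open import Relation.Nullary.Decidable using (does-⇔; dec-true; dec-false)
open import Relation.Unary using (Pred; Decidable)

private variable
  A B : Set
  c n : ℕ

-- Sums, shuffles and arrangements

infixr 5 ∑
∑ : List A → (A → ℕ) → ℕ
∑ []       f = 0
∑ (x ∷ xs) f = f x + ∑ xs f

syntax ∑ xs (λ x → e) = ∑[ x ∈ xs ] e

∑-cong-∈ : ∀ (xs : List A) {f g : A → ℕ} → (∀ {x} → x ∈ xs → f x ≡ g x) → ∑ xs f ≡ ∑ xs g
∑-cong-∈ []       e = refl
∑-cong-∈ (x ∷ xs) e = cong₂ _+_ (e (here refl)) (∑-cong-∈ xs (e ∘ there))

∑-cong : ∀ (xs : List A) {f g : A → ℕ} → (∀ x → f x ≡ g x) → ∑ xs f ≡ ∑ xs g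
∑-cong xs e = ∑-cong-∈ xs (λ {x} _ → e x)

∑-++ : ∀ (xs ys : List A) {f} → ∑ (xs ++ ys) f ≡ ∑ xs f + ∑ ys f
∑-++ []       ys     = refl
∑-++ (x ∷ xs) ys {f} = trans (cong (f x +_) (∑-++ xs ys)) (sym (+-assoc (f x) _ _))

∑-map : ∀ (g : B → A) xs {f} → ∑ (map g xs) f ≡ ∑[ x ∈ xs ] f (g x)
∑-map g []       = refl
∑-map g (x ∷ xs) = cong (_ +_) (∑-map g xs)

∑-concatMap : ∀ (g : B → List A) xs {f} → ∑ (concatMap g xs) f ≡ ∑[ x ∈ xs ] ∑[ y ∈ g x ] f y
∑-concatMap g []       = refl
∑-concatMap g (x ∷ xs) = trans (∑-++ (g x) _) (cong (_ +_) (∑-concatMap g xs))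

∑-+ : ∀ (xs : List A) {f g} → ∑[ x ∈ xs ] (f x + g x) ≡ ∑ xs f + ∑ xs g
∑-+ []       = refl
∑-+ (x ∷ xs) {f} {g} = trans (cong (f x + g x +_) (∑-+ xs)) (+-+-interchange (f x) (g x) _ _)
  where
  +-+-interchange : ∀ a b c d → a + b + (c + d) ≡ a + c + (b + d)
  +-+-interchange = solve-∀

∑-0 : ∀ (xs : List A) → ∑[ x ∈ xs ] 0 ≡ 0
∑-0 []       = refl
∑-0 (x ∷ xs) = ∑-0 xs

∑-swap : ∀ (xs : List A) (ys : List B) {f : A → B → ℕ} → ∑[ x ∈ xs ] ∑[ y ∈ ys ] f x y ≡ ∑[ y ∈ ys ] ∑[ x ∈ xs ] f x y
∑-swap []       ys = sym (∑-0 ys)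
∑-swap (x ∷ xs) ys = trans (cong (_ +_) (∑-swap xs ys)) (sym (∑-+ ys))

∑-const : ∀ (xs : List A) c → ∑[ x ∈ xs ] c ≡ length xs * c
∑-const []       c = refl
∑-const (x ∷ xs) c = cong (c +_) (∑-const xs c)

∑-*ˡ : ∀ (xs : List A) {f} c → ∑[ x ∈ xs ] (c * f x) ≡ c * ∑ xs f
∑-*ˡ []           c = sym (*-zeroʳ c)
∑-*ˡ (x ∷ xs) {f} c = trans (cong (c * f x +_) (∑-*ˡ xs c)) (sym (*-distribˡ-+ c (f x) _))

∑-↭ : ∀ {xs ys : List A} {f} → xs ↭ ys → ∑ xs f ≡ ∑ ys f
∑-↭ _↭_.refl                = refl
∑-↭ {f = f} (prep x p)      = cong (f x +_) (∑-↭ p)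
∑-↭ {f = f} (swap x y p)    = trans (cong (λ s → f x + (f y + s)) (∑-↭ p)) (+-swap (f x) (f y) _)
  where
  +-swap : ∀ a b c → a + (b + c) ≡ b + (a + c)
  +-swap = solve-∀
∑-↭ (_↭_.trans p q)         = trans (∑-↭ p) (∑-↭ q)

upTo-suc : ∀ n → upTo (suc n) ≡ 0 ∷ map suc (upTo n)
upTo-suc n = cong (0 ∷_) (sym (map-upTo suc n))

∑-upTo-suc : ∀ n f → ∑ (upTo (suc n)) f ≡ f 0 + (∑[ x ∈ upTo n ] f (suc x))
∑-upTo-suc n f = trans (cong (λ xs → ∑ xs f) (upTo-suc n)) (cong (f 0 +_) (∑-map suc (upTo n)))

upTo-+ : ∀ a b → upTo (a + b) ≡ upTo a ++ map (a +_) (upTo b)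
upTo-+ zero    b = sym (map-id (upTo b))
upTo-+ (suc a) b = begin
  upTo (suc (a + b))                                        ≡⟨ upTo-suc (a + b) ⟩
  0 ∷ map suc (upTo (a + b))                                ≡⟨ cong (λ xs → 0 ∷ map suc xs) (upTo-+ a b) ⟩
  0 ∷ map suc (upTo a ++ map (a +_) (upTo b))               ≡⟨ cong (0 ∷_) (map-++ suc (upTo a) _) ⟩
  0 ∷ map suc (upTo a) ++ map suc (map (a +_) (upTo b))     ≡⟨ cong₂ _++_ (sym (upTo-suc a)) (sym (map-∘ (upTo b))) ⟩
  upTo (suc a) ++ map (suc a +_) (upTo b)                   ∎
  where open ≡-Reasoning

-- Interleavings are listed with multiplicity, so sums over them split by the first letter without
-- any distinctness condition on the letters.
shuffles : List A → List A → List (List A)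
shuffles []      v       = [ v ]
shuffles (x ∷ u) []      = [ x ∷ u ]
shuffles (x ∷ u) (y ∷ v) = map (x ∷_) (shuffles u (y ∷ v)) ++ map (y ∷_) (shuffles (x ∷ u) v)

-- Inserting a letter is written as shuffling with a one-letter word, so that associativity of
-- shuffles applies to it.
arrangements : List A → List (List A)
arrangements []       = [ [] ]
arrangements (x ∷ xs) = concatMap (shuffles [ x ]) (arrangements xs)

∑-shuffles-∷ : ∀ (x : A) u y v {f} → ∑ (shuffles (x ∷ u) (y ∷ v)) f ≡
  (∑[ z ∈ shuffles u (y ∷ v) ] f (x ∷ z)) + (∑[ z ∈ shuffles (x ∷ u) v ] f (y ∷ z))
∑-shuffles-∷ x u y v = trans (∑-++ (map (x ∷_) (shuffles u (y ∷ v))) _)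
  (cong₂ _+_ (∑-map (x ∷_) (shuffles u (y ∷ v))) (∑-map (y ∷_) (shuffles (x ∷ u) v)))

∑-shuffles-[]ʳ : ∀ (u : List A) {f} → ∑ (shuffles u []) f ≡ f u
∑-shuffles-[]ʳ []      = +-identityʳ _
∑-shuffles-[]ʳ (x ∷ u) = +-identityʳ _

-- Both sides run over the interleavings of three words. For nonempty words they are grouped by the
-- first letter of the result, `x`, `y` or `s`. On the left the sums starting with `x` are first
-- recombined into one sum over the shuffles of the other two words, and after the induction the sum
-- starting with `s` is split in the same way.
∑-shuffles-assoc : ∀ (u v w : List A) {f} →
  (∑[ z ∈ shuffles v w ] ∑ (shuffles u z) f) ≡ (∑[ z ∈ shuffles u v ] ∑ (shuffles z w) f)
∑-shuffles-assoc [] v w = trans (∑-cong (shuffles v w) (λ z → +-identityʳ _)) (sym (+-identityʳ _))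
∑-shuffles-assoc (x ∷ u) [] w = refl
∑-shuffles-assoc (x ∷ u) (y ∷ v) [] = trans (+-identityʳ _)
  (sym (∑-cong (shuffles (x ∷ u) (y ∷ v)) (λ z → ∑-shuffles-[]ʳ z)))
∑-shuffles-assoc (x ∷ u) (y ∷ v) (s ∷ w) {f} = begin
  (∑[ z ∈ shuffles (y ∷ v) (s ∷ w) ] ∑ (shuffles (x ∷ u) z) f)
    ≡⟨ ∑-shuffles-∷ y v s w ⟩
  (∑[ z ∈ shuffles v (s ∷ w) ] ∑ (shuffles (x ∷ u) (y ∷ z)) f) + (∑[ z ∈ shuffles (y ∷ v) w ] ∑ (shuffles (x ∷ u) (s ∷ z)) f)
    ≡⟨ cong₂ _+_ (trans (∑-cong (shuffles v (s ∷ w)) (λ z → ∑-shuffles-∷ x u y z)) (∑-+ (shuffles v (s ∷ w))))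
                 (trans (∑-cong (shuffles (y ∷ v) w) (λ z → ∑-shuffles-∷ x u s z)) (∑-+ (shuffles (y ∷ v) w))) ⟩
  (∑[ z ∈ shuffles v (s ∷ w) ] ∑ (shuffles u (y ∷ z)) fx) + (∑[ z ∈ shuffles v (s ∷ w) ] ∑ (shuffles (x ∷ u) z) fy)
    + ((∑[ z ∈ shuffles (y ∷ v) w ] ∑ (shuffles u (s ∷ z)) fx) + (∑[ z ∈ shuffles (y ∷ v) w ] ∑ (shuffles (x ∷ u) z) fs))
    ≡⟨ rearrange₁ (∑[ z ∈ shuffles v (s ∷ w) ] ∑ (shuffles u (y ∷ z)) fx) (∑[ z ∈ shuffles v (s ∷ w) ] ∑ (shuffles (x ∷ u) z) fy)
                  (∑[ z ∈ shuffles (y ∷ v) w ] ∑ (shuffles u (s ∷ z)) fx) _ ⟩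
  (∑[ z ∈ shuffles v (s ∷ w) ] ∑ (shuffles u (y ∷ z)) fx) + (∑[ z ∈ shuffles (y ∷ v) w ] ∑ (shuffles u (s ∷ z)) fx)
    + (∑[ z ∈ shuffles v (s ∷ w) ] ∑ (shuffles (x ∷ u) z) fy) + (∑[ z ∈ shuffles (y ∷ v) w ] ∑ (shuffles (x ∷ u) z) fs)
    ≡⟨ cong₂ _+_ (cong₂ _+_ (trans (sym (∑-shuffles-∷ y v s w)) (∑-shuffles-assoc u (y ∷ v) (s ∷ w)))
         (∑-shuffles-assoc (x ∷ u) v (s ∷ w))) (trans (∑-shuffles-assoc (x ∷ u) (y ∷ v) w) (∑-shuffles-∷ x u y v)) ⟩
  (∑[ z ∈ shuffles u (y ∷ v) ] ∑ (shuffles z (s ∷ w)) fx) + (∑[ z ∈ shuffles (x ∷ u) v ] ∑ (shuffles z (s ∷ w)) fy)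
    + ((∑[ z ∈ shuffles u (y ∷ v) ] ∑ (shuffles (x ∷ z) w) fs) + (∑[ z ∈ shuffles (x ∷ u) v ] ∑ (shuffles (y ∷ z) w) fs))
    ≡⟨ rearrange₂ (∑[ z ∈ shuffles u (y ∷ v) ] ∑ (shuffles z (s ∷ w)) fx) (∑[ z ∈ shuffles (x ∷ u) v ] ∑ (shuffles z (s ∷ w)) fy)
                  (∑[ z ∈ shuffles u (y ∷ v) ] ∑ (shuffles (x ∷ z) w) fs) _ ⟩
  (∑[ z ∈ shuffles u (y ∷ v) ] ∑ (shuffles z (s ∷ w)) fx) + (∑[ z ∈ shuffles u (y ∷ v) ] ∑ (shuffles (x ∷ z) w) fs)
    + ((∑[ z ∈ shuffles (x ∷ u) v ] ∑ (shuffles z (s ∷ w)) fy) + (∑[ z ∈ shuffles (x ∷ u) v ] ∑ (shuffles (y ∷ z) w) fs))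
    ≡⟨ cong₂ _+_ (trans (∑-cong (shuffles u (y ∷ v)) (λ z → ∑-shuffles-∷ x z s w)) (∑-+ (shuffles u (y ∷ v))))
                 (trans (∑-cong (shuffles (x ∷ u) v) (λ z → ∑-shuffles-∷ y z s w)) (∑-+ (shuffles (x ∷ u) v))) ⟨
  (∑[ z ∈ shuffles u (y ∷ v) ] ∑ (shuffles (x ∷ z) (s ∷ w)) f) + (∑[ z ∈ shuffles (x ∷ u) v ] ∑ (shuffles (y ∷ z) (s ∷ w)) f)
    ≡⟨ ∑-shuffles-∷ x u y v ⟨
  (∑[ z ∈ shuffles (x ∷ u) (y ∷ v) ] ∑ (shuffles z (s ∷ w)) f) ∎
  where
  open ≡-Reasoning
  fx = λ z → f (x ∷ z)
  fy = λ z → f (y ∷ z)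
  fs = λ z → f (s ∷ z)
  rearrange₁ : ∀ a b c d → a + b + (c + d) ≡ a + c + b + d
  rearrange₁ = solve-∀
  rearrange₂ : ∀ a b c d → a + b + (c + d) ≡ a + c + (b + d)
  rearrange₂ = solve-∀

-- This splits a permutation into its small and its large letters. Since insertion is a shuffle with
-- `[ x ]`, the induction on `xs` is associativity of shuffles.
∑-arrangements-++ : ∀ (xs ys : List A) {f} → ∑ (arrangements (xs ++ ys)) f ≡
  ∑[ u ∈ arrangements xs ] ∑[ v ∈ arrangements ys ] ∑ (shuffles u v) f
∑-arrangements-++ []       ys     = sym (trans (+-identityʳ _) (∑-cong (arrangements ys) (λ v → +-identityʳ _)))
∑-arrangements-++ (x ∷ xs) ys {f} = begin
  ∑ (arrangements (x ∷ xs ++ ys)) f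
    ≡⟨ ∑-concatMap _ (arrangements (xs ++ ys)) ⟩
  (∑[ z ∈ arrangements (xs ++ ys) ] ∑ (shuffles [ x ] z) f)
    ≡⟨ ∑-arrangements-++ xs ys ⟩
  (∑[ u ∈ arrangements xs ] ∑[ v ∈ arrangements ys ] ∑[ z ∈ shuffles u v ] ∑ (shuffles [ x ] z) f)
    ≡⟨ ∑-cong (arrangements xs) (λ u → ∑-cong (arrangements ys) (λ v → ∑-shuffles-assoc [ x ] u v)) ⟩
  (∑[ u ∈ arrangements xs ] ∑[ v ∈ arrangements ys ] ∑[ z ∈ shuffles [ x ] u ] ∑ (shuffles z v) f)
    ≡⟨ ∑-cong (arrangements xs) (λ u → ∑-swap (arrangements ys) (shuffles [ x ] u)) ⟩
  (∑[ u ∈ arrangements xs ] ∑[ z ∈ shuffles [ x ] u ] ∑[ v ∈ arrangements ys ] ∑ (shuffles z v) f)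
    ≡⟨ ∑-concatMap _ (arrangements xs) ⟨
  (∑[ z ∈ arrangements (x ∷ xs) ] ∑[ v ∈ arrangements ys ] ∑ (shuffles z v) f) ∎
  where open ≡-Reasoning

shuffles-map : ∀ (g : A → B) u v → shuffles (map g u) (map g v) ≡ map (map g) (shuffles u v)
shuffles-map g []      v       = refl
shuffles-map g (x ∷ u) []      = refl
shuffles-map g (x ∷ u) (y ∷ v) = begin
  map (g x ∷_) (shuffles (map g u) (map g (y ∷ v))) ++ map (g y ∷_) (shuffles (map g (x ∷ u)) (map g v))
    ≡⟨ cong₂ _++_ (pull x (shuffles-map g u (y ∷ v))) (pull y (shuffles-map g (x ∷ u) v)) ⟩
  map (map g) (map (x ∷_) (shuffles u (y ∷ v))) ++ map (map g) (map (y ∷_) (shuffles (x ∷ u) v))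
    ≡⟨ map-++ (map g) (map (x ∷_) (shuffles u (y ∷ v))) _ ⟨
  map (map g) (shuffles (x ∷ u) (y ∷ v)) ∎
  where
  open ≡-Reasoning
  pull : ∀ a {zs ws} → zs ≡ map (map g) ws → map (g a ∷_) zs ≡ map (map g) (map (a ∷_) ws)
  pull a {ws = ws} refl = trans (sym (map-∘ ws)) (map-∘ ws)

∑-arrangements-map : ∀ (g : A → B) xs {f} → ∑ (arrangements (map g xs)) f ≡ ∑[ u ∈ arrangements xs ] f (map g u)
∑-arrangements-map g []           = refl
∑-arrangements-map g (x ∷ xs) {f} = begin
  ∑ (arrangements (map g (x ∷ xs))) f
    ≡⟨ ∑-concatMap _ (arrangements (map g xs)) ⟩
  (∑[ z ∈ arrangements (map g xs) ] ∑ (shuffles [ g x ] z) f)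
    ≡⟨ ∑-arrangements-map g xs ⟩
  (∑[ u ∈ arrangements xs ] ∑ (shuffles (map g [ x ]) (map g u)) f)
    ≡⟨ ∑-cong (arrangements xs) (λ u → trans (cong (λ zs → ∑ zs f) (shuffles-map g [ x ] u)) (∑-map (map g) (shuffles [ x ] u))) ⟩
  (∑[ u ∈ arrangements xs ] ∑[ z ∈ shuffles [ x ] u ] f (map g z))
    ≡⟨ ∑-concatMap _ (arrangements xs) ⟨
  (∑[ u ∈ arrangements (x ∷ xs) ] f (map g u)) ∎
  where open ≡-Reasoning

interleaving-[]ˡ : ∀ (v : List A) → Interleaving [] v v
interleaving-[]ˡ []      = []
interleaving-[]ˡ (y ∷ v) = consʳ (interleaving-[]ˡ v)

interleaving-[]ʳ : ∀ (u : List A) → Interleaving u [] u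
interleaving-[]ʳ []      = []
interleaving-[]ʳ (y ∷ v) = consˡ (interleaving-[]ʳ v)

∈-shuffles⁻ : ∀ (u v : List A) {z} → z ∈ shuffles u v → Interleaving u v z
∈-shuffles⁻ []      v       (here refl) = interleaving-[]ˡ v
∈-shuffles⁻ (x ∷ u) []      (here refl) = interleaving-[]ʳ (x ∷ u)
∈-shuffles⁻ (x ∷ u) (y ∷ v) z∈ with ∈-++⁻ (map (x ∷_) (shuffles u (y ∷ v))) z∈
... | inj₁ z∈ˡ with _ , w∈ , refl ← ∈-map⁻ (x ∷_) z∈ˡ = consˡ (∈-shuffles⁻ u (y ∷ v) w∈)
... | inj₂ z∈ʳ with _ , w∈ , refl ← ∈-map⁻ (y ∷_) z∈ʳ = consʳ (∈-shuffles⁻ (x ∷ u) v w∈)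

∈-arrangements⁻ : ∀ (xs : List A) {z} → z ∈ arrangements xs → z ↭ xs
∈-arrangements⁻ []       (here refl) = ↭-refl
∈-arrangements⁻ (x ∷ xs) z∈ with find (∈-concatMap⁻ (shuffles [ x ]) {xs = arrangements xs} z∈)
... | w , w∈ , z∈' = ↭-trans (toPermutation (∈-shuffles⁻ [ x ] w z∈')) (prep x (∈-arrangements⁻ xs w∈))

-- A letter can be inserted into a word of length m in m + 1 ways, whence the factorial.
∑-arrangements-const : ∀ (xs : List A) c → ∑[ u ∈ arrangements xs ] c ≡ length xs ! * c
∑-arrangements-const []       c = refl
∑-arrangements-const (x ∷ xs) c = begin
  (∑[ u ∈ arrangements (x ∷ xs) ] c)
    ≡⟨ ∑-concatMap _ (arrangements xs) ⟩
  (∑[ u ∈ arrangements xs ] ∑[ z ∈ shuffles [ x ] u ] c)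
    ≡⟨ ∑-cong-∈ (arrangements xs) (λ {u} u∈ →
         trans (insertions u) (cong (λ m → suc m * c) (↭-length (∈-arrangements⁻ xs u∈)))) ⟩
  (∑[ u ∈ arrangements xs ] (suc (length xs) * c))
    ≡⟨ ∑-arrangements-const xs (suc (length xs) * c) ⟩
  length xs ! * (suc (length xs) * c)
    ≡⟨ *-assoc (length xs !) (suc (length xs)) c ⟨
  length xs ! * suc (length xs) * c
    ≡⟨ cong (_* c) (*-comm (length xs !) (suc (length xs))) ⟩
  suc (length xs) ! * c ∎
  where
  open ≡-Reasoning
  insertions : ∀ u → ∑[ z ∈ shuffles [ x ] u ] c ≡ suc (length u) * c
  insertions []      = refl
  insertions (y ∷ u) = cong (c +_) (trans (∑-map (y ∷_) (shuffles [ x ] u)) (insertions u))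

-- Gaussian binomials

-- The Gaussian binomial [a + b choose a] acting on test functions: q ^ t acts as evaluation at t.
gauss : ℕ → ℕ → (ℕ → ℕ) → ℕ
gauss zero    b       f = f 0
gauss (suc a) zero    f = f 0
gauss (suc a) (suc b) f = gauss (suc a) b f + gauss a (suc b) (λ t → f (suc b + t))

gauss-cong : ∀ a b {f g} → (∀ t → f t ≡ g t) → gauss a b f ≡ gauss a b g
gauss-cong zero    b       e = e 0
gauss-cong (suc a) zero    e = e 0
gauss-cong (suc a) (suc b) e = cong₂ _+_ (gauss-cong (suc a) b e) (gauss-cong a (suc b) (λ t → e (suc b + t)))

-- The definition of `gauss` is one Pascal rule; this is its mirror image. In the main case both
-- sides unfold, by the definition and the induction hypotheses, to the same four terms, the doubly
-- shifted ones agreeing because both carry the exponent a + b + 3.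
gauss-pascal : ∀ a b f → gauss (suc a) (suc b) f ≡ gauss a (suc b) f + gauss (suc a) b (λ t → f (suc a + t))
gauss-pascal zero    zero    f = refl
gauss-pascal (suc a) zero    f = begin
  f 0 + gauss (suc a) 1 (λ t → f (1 + t))
    ≡⟨ cong (f 0 +_) (gauss-pascal a zero _) ⟩
  f 0 + (gauss a 1 (λ t → f (1 + t)) + f (1 + (suc a + 0)))
    ≡⟨ +-assoc (f 0) _ _ ⟨
  f 0 + gauss a 1 (λ t → f (1 + t)) + f (suc (suc a) + 0) ∎
  where open ≡-Reasoning
gauss-pascal zero    (suc b) f = begin
  gauss 1 (suc b) f + f (suc (suc b) + 0)
    ≡⟨ cong (_+ f (suc (suc b) + 0)) (gauss-pascal zero b f) ⟩
  f 0 + gauss 1 b (λ t → f (1 + t)) + f (suc (suc b) + 0)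
    ≡⟨ +-assoc (f 0) _ _ ⟩
  f 0 + gauss 1 (suc b) (λ t → f (1 + t)) ∎
  where open ≡-Reasoning
gauss-pascal (suc a) (suc b) f = begin
  gauss (2 + a) (suc b) f + gauss (suc a) (2 + b) (λ t → f (2 + b + t))
    ≡⟨ cong₂ _+_ (gauss-pascal (suc a) b f) (gauss-pascal a (suc b) _) ⟩
  gauss (suc a) (suc b) f + gauss (2 + a) b (λ t → f (2 + a + t))
    + (gauss a (2 + b) (λ t → f (2 + b + t)) + gauss (suc a) (suc b) (λ t → f (2 + b + (suc a + t))))
    ≡⟨ cong (λ s → gauss (suc a) (suc b) f + gauss (2 + a) b (λ t → f (2 + a + t)) + (gauss a (2 + b) (λ t → f (2 + b + t)) + s))
         (gauss-cong (suc a) (suc b) (λ t → cong f (exponent a b t))) ⟩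
  gauss (suc a) (suc b) f + gauss (2 + a) b (λ t → f (2 + a + t))
    + (gauss a (2 + b) (λ t → f (2 + b + t)) + gauss (suc a) (suc b) (λ t → f (2 + a + (suc b + t))))
    ≡⟨ rearrange (gauss (suc a) (suc b) f) (gauss (2 + a) b (λ t → f (2 + a + t))) (gauss a (2 + b) (λ t → f (2 + b + t))) _ ⟩
  gauss (suc a) (suc b) f + gauss a (2 + b) (λ t → f (2 + b + t))
    + (gauss (2 + a) b (λ t → f (2 + a + t)) + gauss (suc a) (suc b) (λ t → f (2 + a + (suc b + t)))) ∎
  where
  open ≡-Reasoning
  exponent : ∀ a b t → 2 + b + (suc a + t) ≡ 2 + a + (suc b + t)
  exponent = solve-∀
  rearrange : ∀ p q r s → p + q + (r + s) ≡ p + r + (q + s)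
  rearrange = solve-∀

Periodic : ℕ → (ℕ → ℕ) → Set
Periodic p f = ∀ x → f (p + x) ≡ f x

Periodic-* : ∀ {p} {f : ℕ → ℕ} → Periodic p f → ∀ c x → f (c * p + x) ≡ f x
Periodic-* {p} {f} per zero    x = refl
Periodic-* {p} {f} per (suc c) x = trans (cong f (+-assoc p (c * p) x)) (trans (per _) (Periodic-* per c x))

-- q ^ a times one Pascal rule is the other Pascal rule modulo q ^ (a + b) = 1.
gauss-shift-a : ∀ a b {f} → Periodic (a + b) f → gauss a b (λ t → f (a + t)) ≡ gauss a b f
gauss-shift-a zero    b       per = refl
gauss-shift-a (suc a) zero    {f} per = trans (cong f (cong (λ c → suc c + 0) (sym (+-identityʳ a)))) (per 0)
gauss-shift-a (suc a) (suc b) {f} per = begin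
  gauss (suc a) b (λ t → f (suc a + t)) + gauss a (suc b) (λ t → f (suc a + (suc b + t)))
    ≡⟨ cong (gauss (suc a) b (λ t → f (suc a + t)) +_) (gauss-cong a (suc b) (λ t → trans (cong f (sym (+-assoc (suc a) (suc b) t))) (per t))) ⟩
  gauss (suc a) b (λ t → f (suc a + t)) + gauss a (suc b) f
    ≡⟨ +-comm _ (gauss a (suc b) f) ⟩
  gauss a (suc b) f + gauss (suc a) b (λ t → f (suc a + t))
    ≡⟨ gauss-pascal a b f ⟨
  gauss (suc a) (suc b) f ∎
  where open ≡-Reasoning

gauss-shift-*a : ∀ a b {f} → Periodic (a + b) f → ∀ c → gauss a b (λ t → f (c * a + t)) ≡ gauss a b f
gauss-shift-*a a b     per zero    = refl
gauss-shift-*a a b {f} per (suc c) = begin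
  gauss a b (λ t → f (a + c * a + t))
    ≡⟨ gauss-cong a b (λ t → cong f (exponent₁ a (c * a) t)) ⟩
  gauss a b (λ t → f (c * a + (a + t)))
    ≡⟨ gauss-shift-a a b (λ t → trans (cong f (exponent₂ (a + b) (c * a) t)) (per (c * a + t))) ⟩
  gauss a b (λ t → f (c * a + t))
    ≡⟨ gauss-shift-*a a b per c ⟩
  gauss a b f ∎
  where
  open ≡-Reasoning
  exponent₁ : ∀ a d t → a + d + t ≡ d + (a + t)
  exponent₁ = solve-∀
  exponent₂ : ∀ p d t → d + (p + t) ≡ p + (d + t)
  exponent₂ = solve-∀

-- Shifts by `a` and by the period `a + b` both leave the value unchanged, and by Bézout 1 is an
-- integer combination of the two. The two cases are the two signs of Bézout's identity over ℕ.
gauss-shift : ∀ a b {f} → Coprime a (a + b) → Periodic (a + b) f → gauss a b (f ∘ suc) ≡ gauss a b f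
gauss-shift a b {f} cop per with coprime-Bézout cop
... | Bézout.+- x y e = begin
  gauss a b (λ t → f (suc t))
    ≡⟨ gauss-cong a b (λ t → Periodic-* per y (suc t)) ⟨
  gauss a b (λ t → f (y * (a + b) + suc t))
    ≡⟨ gauss-cong a b (λ t → cong f (trans (+-suc _ t) (cong (_+ t) e))) ⟩
  gauss a b (λ t → f (x * a + t))
    ≡⟨ gauss-shift-*a a b per x ⟩
  gauss a b f ∎
  where open ≡-Reasoning
... | Bézout.-+ x y e = begin
  gauss a b (λ t → f (suc t))
    ≡⟨ gauss-shift-*a a b (λ t → trans (cong f (sym (+-suc (a + b) t))) (per (suc t))) x ⟨
  gauss a b (λ t → f (suc (x * a + t)))
    ≡⟨ gauss-cong a b (λ t → cong (λ c → f (c + t)) e) ⟩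
  gauss a b (λ t → f (y * (a + b) + t))
    ≡⟨ gauss-cong a b (λ t → Periodic-* per y t) ⟩
  gauss a b f ∎
  where open ≡-Reasoning

gauss-shift-+ : ∀ a b {f} → Coprime a (a + b) → Periodic (a + b) f → ∀ c → gauss a b (λ t → f (c + t)) ≡ gauss a b f
gauss-shift-+ a b     cop per zero    = refl
gauss-shift-+ a b {f} cop per (suc c) = trans
  (gauss-shift-+ a b cop (λ t → trans (cong f (sym (+-suc (a + b) t))) (per (suc t))) c)
  (gauss-shift a b cop per)

-- The shuffle theorem

-- The major index of the reversal of a word: read from its end, a word has its
-- descent positions given by the lengths of the remaining tails.
rmaj : List ℕ → ℕ
rmaj []          = 0
rmaj (b ∷ [])    = 0
rmaj (b ∷ a ∷ w) = (if b <ᵇ a then suc (length w) else 0) + rmaj (a ∷ w)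

<ᵇ-true : ∀ {m n} → m < n → (m <ᵇ n) ≡ true
<ᵇ-true = Equivalence.to T-≡ ∘ <⇒<ᵇ

<ᵇ-false : ∀ {m n} → n ≤ m → (m <ᵇ n) ≡ false
<ᵇ-false {m} n≤m = ¬-not (λ e → <⇒≱ (<ᵇ⇒< m _ (Equivalence.from T-≡ e)) n≤m)

rmaj-∷-asc : ∀ {b a} w → a ≤ b → rmaj (b ∷ a ∷ w) ≡ rmaj (a ∷ w)
rmaj-∷-asc {b} {a} w a≤b rewrite <ᵇ-false a≤b = refl

rmaj-∷-desc : ∀ {b a} w → b < a → rmaj (b ∷ a ∷ w) ≡ suc (length w) + rmaj (a ∷ w)
rmaj-∷-desc {b} {a} w b<a rewrite <ᵇ-true b<a = refl

length-∈-shuffles : ∀ (u v : List A) {z} → z ∈ shuffles u v → length z ≡ length u + length v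
length-∈-shuffles u v z∈ = trans (↭-length (toPermutation (∈-shuffles⁻ u v z∈))) (length-++ u)

-- The inductive step of `∑-rmaj-small`: `d` is `x <ᵇ x'`, and `m`, `n` are `rmaj (x' ∷ u)`,
-- `rmaj (y ∷ v)`. If `d` holds, the identity is the defining Pascal rule; otherwise it is the
-- mirror rule.
gauss-small : ∀ (d : Bool) a b m n (f : ℕ → ℕ) →
  gauss a (suc b) (λ t → f ((if d then suc (a + suc b) else 0) + (m + n + (suc b + t))))
    + gauss (suc a) b (λ t → f (suc (suc a + b) + (m + n + t)))
  ≡ gauss (suc a) (suc b) (λ t → f ((if d then suc a else 0) + m + n + (suc b + t)))
gauss-small false a b m n f = trans
  (cong (gauss a (suc b) (λ t → f (m + n + (suc b + t))) +_) (gauss-cong (suc a) b (λ t → cong f (exponent a b m n t))))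
  (sym (gauss-pascal a b (λ t → f (m + n + (suc b + t)))))
  where
  exponent : ∀ a b m n t → suc (suc a + b) + (m + n + t) ≡ m + n + (suc b + (suc a + t))
  exponent = solve-∀
gauss-small true a b m n f = trans
  (cong₂ _+_ (gauss-cong a (suc b) (λ t → cong f (exponent₁ a b m n t))) (gauss-cong (suc a) b (λ t → cong f (exponent₂ a b m n t))))
  (+-comm (gauss a (suc b) (λ t → f (suc a + m + n + (suc b + (suc b + t))))) _)
  where
  exponent₁ : ∀ a b m n t → suc (a + suc b) + (m + n + (suc b + t)) ≡ suc a + m + n + (suc b + (suc b + t))
  exponent₁ = solve-∀
  exponent₂ : ∀ a b m n t → suc (suc a + b) + (m + n + t) ≡ suc a + m + n + (suc b + t)
  exponent₂ = solve-∀

-- The inductive step of `∑-rmaj-large`, with `d` standing for `y <ᵇ y'`. The two Pascal rules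
-- exchange their roles: the mirror rule serves when `d` holds.
gauss-large : ∀ (d : Bool) a b m n (f : ℕ → ℕ) →
  gauss a (suc b) (λ t → f (m + n + (suc b + t)))
    + gauss (suc a) b (λ t → f ((if d then suc (suc a + b) else 0) + (m + n + t)))
  ≡ gauss (suc a) (suc b) (λ t → f (m + ((if d then suc b else 0) + n) + t))
gauss-large false a b m n f = +-comm (gauss a (suc b) (λ t → f (m + n + (suc b + t)))) _
gauss-large true  a b m n f = trans
  (cong₂ _+_ (gauss-cong a (suc b) (λ t → cong f (exponent₁ b m n t))) (gauss-cong (suc a) b (λ t → cong f (exponent₂ a b m n t))))
  (sym (gauss-pascal a b (λ t → f (m + (suc b + n) + t))))
  where
  exponent₁ : ∀ b m n t → m + n + (suc b + t) ≡ m + (suc b + n) + t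
  exponent₁ = solve-∀
  exponent₂ : ∀ a b m n t → suc (suc a + b) + (m + n + t) ≡ m + (suc b + n) + (suc a + t)
  exponent₂ = solve-∀

-- The first letter is kept fixed because `rmaj` compares it with the letter that follows. This
-- lemma and `∑-rmaj-large` evaluate the two summands of the defining Pascal rule: shuffles that
-- start with a small letter carry the extra factor q ^ `length v`, those that start with a large
-- letter do not.
∑-rmaj-small : ∀ {x u v} → x < c → All (_< c) u → All (c ≤_) v → ∀ (f : ℕ → ℕ) →
  ∑[ z ∈ shuffles u v ] f (rmaj (x ∷ z)) ≡
  gauss (length u) (length v) (λ t → f (rmaj (x ∷ u) + rmaj v + (length v + t)))
∑-rmaj-large : ∀ {y u v} → c ≤ y → All (_< c) u → All (c ≤_) v → ∀ (f : ℕ → ℕ) →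
  ∑[ z ∈ shuffles u v ] f (rmaj (y ∷ z)) ≡
  gauss (length u) (length v) (λ t → f (rmaj u + rmaj (y ∷ v) + t))

∑-rmaj-small {x = x} {[]} {[]} x<c [] [] f = +-identityʳ _
∑-rmaj-small {x = x} {[]} {y ∷ v} x<c [] (c≤y ∷ _) f = trans (+-identityʳ _) (cong f (begin
  rmaj (x ∷ y ∷ v)                     ≡⟨ rmaj-∷-desc v (<-≤-trans x<c c≤y) ⟩
  suc (length v) + rmaj (y ∷ v)        ≡⟨ +-comm (suc (length v)) _ ⟩
  rmaj (y ∷ v) + suc (length v)        ≡⟨ cong (rmaj (y ∷ v) +_) (+-identityʳ _) ⟨
  rmaj (y ∷ v) + (suc (length v) + 0)  ∎))
  where open ≡-Reasoning
∑-rmaj-small {x = x} {x' ∷ u} {[]} x<c _ [] f =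
  trans (+-identityʳ _) (cong f (sym (trans (+-identityʳ _) (+-identityʳ _))))
∑-rmaj-small {c} {x} {x' ∷ u} {y ∷ v} x<c us@(x'<c ∷ u<c) vs@(c≤y ∷ c≤v) f = begin
  (∑[ z ∈ shuffles (x' ∷ u) (y ∷ v) ] f (rmaj (x ∷ z)))
    ≡⟨ ∑-shuffles-∷ x' u y v ⟩
  (∑[ z ∈ shuffles u (y ∷ v) ] f (rmaj (x ∷ x' ∷ z))) + (∑[ z ∈ shuffles (x' ∷ u) v ] f (rmaj (x ∷ y ∷ z)))
    ≡⟨ cong₂ _+_
         (∑-cong-∈ (shuffles u (y ∷ v)) λ {z} z∈ →
           cong (λ m → f ((if x <ᵇ x' then suc m else 0) + rmaj (x' ∷ z))) (length-∈-shuffles u (y ∷ v) z∈))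
         (∑-cong-∈ (shuffles (x' ∷ u) v) λ {z} z∈ →
           cong f (trans (rmaj-∷-desc z (<-≤-trans x<c c≤y))
                         (cong (λ m → suc m + rmaj (y ∷ z)) (length-∈-shuffles (x' ∷ u) v z∈)))) ⟩
  (∑[ z ∈ shuffles u (y ∷ v) ] f ((if x <ᵇ x' then suc (a + suc b) else 0) + rmaj (x' ∷ z)))
    + (∑[ z ∈ shuffles (x' ∷ u) v ] f (suc (suc a + b) + rmaj (y ∷ z)))
    ≡⟨ cong₂ _+_ (∑-rmaj-small x'<c u<c vs (λ m → f ((if x <ᵇ x' then suc (a + suc b) else 0) + m)))
                 (∑-rmaj-large c≤y us c≤v (λ m → f (suc (suc a + b) + m))) ⟩
  gauss a (suc b) (λ t → f ((if x <ᵇ x' then suc (a + suc b) else 0) + (rmaj (x' ∷ u) + rmaj (y ∷ v) + (suc b + t))))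
    + gauss (suc a) b (λ t → f (suc (suc a + b) + (rmaj (x' ∷ u) + rmaj (y ∷ v) + t)))
    ≡⟨ gauss-small (x <ᵇ x') a b (rmaj (x' ∷ u)) (rmaj (y ∷ v)) f ⟩
  gauss (suc a) (suc b) (λ t → f (rmaj (x ∷ x' ∷ u) + rmaj (y ∷ v) + (suc b + t))) ∎
  where
  open ≡-Reasoning
  a = length u
  b = length v

∑-rmaj-large {y = y} {[]} {v} c≤y [] _ f = trans (+-identityʳ _) (cong f (sym (+-identityʳ _)))
∑-rmaj-large {y = y} {x ∷ u} {[]} c≤y (x<c ∷ _) [] f = trans (+-identityʳ _)
  (cong f (trans (rmaj-∷-asc u (<⇒≤ (<-≤-trans x<c c≤y))) (sym (trans (+-identityʳ _) (+-identityʳ _)))))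
∑-rmaj-large {c} {y} {x ∷ u} {y' ∷ v} c≤y us@(x<c ∷ u<c) vs@(c≤y' ∷ c≤v) f = begin
  (∑[ z ∈ shuffles (x ∷ u) (y' ∷ v) ] f (rmaj (y ∷ z)))
    ≡⟨ ∑-shuffles-∷ x u y' v ⟩
  (∑[ z ∈ shuffles u (y' ∷ v) ] f (rmaj (y ∷ x ∷ z))) + (∑[ z ∈ shuffles (x ∷ u) v ] f (rmaj (y ∷ y' ∷ z)))
    ≡⟨ cong₂ _+_
         (∑-cong (shuffles u (y' ∷ v)) λ z → cong f (rmaj-∷-asc z (<⇒≤ (<-≤-trans x<c c≤y))))
         (∑-cong-∈ (shuffles (x ∷ u) v) λ {z} z∈ →
           cong (λ m → f ((if y <ᵇ y' then suc m else 0) + rmaj (y' ∷ z))) (length-∈-shuffles (x ∷ u) v z∈)) ⟩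
  (∑[ z ∈ shuffles u (y' ∷ v) ] f (rmaj (x ∷ z)))
    + (∑[ z ∈ shuffles (x ∷ u) v ] f ((if y <ᵇ y' then suc (suc a + b) else 0) + rmaj (y' ∷ z)))
    ≡⟨ cong₂ _+_ (∑-rmaj-small x<c u<c vs f)
                 (∑-rmaj-large c≤y' us c≤v (λ m → f ((if y <ᵇ y' then suc (suc a + b) else 0) + m))) ⟩
  gauss a (suc b) (λ t → f (rmaj (x ∷ u) + rmaj (y' ∷ v) + (suc b + t)))
    + gauss (suc a) b (λ t → f ((if y <ᵇ y' then suc (suc a + b) else 0) + (rmaj (x ∷ u) + rmaj (y' ∷ v) + t)))
    ≡⟨ gauss-large (y <ᵇ y') a b (rmaj (x ∷ u)) (rmaj (y' ∷ v)) f ⟩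
  gauss (suc a) (suc b) (λ t → f (rmaj (x ∷ u) + rmaj (y ∷ y' ∷ v) + t)) ∎
  where
  open ≡-Reasoning
  a = length u
  b = length v

-- Sorting the shuffles by whether their first letter is small or large produces exactly the two
-- summands in the definition of `gauss`.
∑-rmaj-shuffles : ∀ {u v} → All (_< c) u → All (c ≤_) v → ∀ (f : ℕ → ℕ) →
  ∑[ z ∈ shuffles u v ] f (rmaj z) ≡ gauss (length u) (length v) (λ t → f (rmaj u + rmaj v + t))
∑-rmaj-shuffles {u = []} {v} _ _ f = trans (+-identityʳ _) (cong f (sym (+-identityʳ _)))
∑-rmaj-shuffles {u = x ∷ u} {[]} _ _ f = trans (+-identityʳ _) (cong f (sym (trans (+-identityʳ _) (+-identityʳ _))))
∑-rmaj-shuffles {c} {x ∷ u} {y ∷ v} us@(x<c ∷ u<c) vs@(c≤y ∷ c≤v) f = begin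
  (∑[ z ∈ shuffles (x ∷ u) (y ∷ v) ] f (rmaj z))
    ≡⟨ ∑-shuffles-∷ x u y v ⟩
  (∑[ z ∈ shuffles u (y ∷ v) ] f (rmaj (x ∷ z))) + (∑[ z ∈ shuffles (x ∷ u) v ] f (rmaj (y ∷ z)))
    ≡⟨ cong₂ _+_ (∑-rmaj-small x<c u<c vs f) (∑-rmaj-large c≤y us c≤v f) ⟩
  gauss (length u) (suc (length v)) (λ t → f (rmaj (x ∷ u) + rmaj (y ∷ v) + (suc (length v) + t)))
    + gauss (suc (length u)) (length v) (λ t → f (rmaj (x ∷ u) + rmaj (y ∷ v) + t))
    ≡⟨ +-comm (gauss (length u) (suc (length v)) (λ t → f (rmaj (x ∷ u) + rmaj (y ∷ v) + (suc (length v) + t)))) _ ⟩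
  gauss (suc (length u)) (suc (length v)) (λ t → f (rmaj (x ∷ u) + rmaj (y ∷ v) + t)) ∎
  where open ≡-Reasoning

rmaj-map-+ : ∀ a w → rmaj (map (a +_) w) ≡ rmaj w
rmaj-map-+ a []          = refl
rmaj-map-+ a (x ∷ [])    = refl
rmaj-map-+ a (x ∷ y ∷ w) = cong₂ _+_
  (cong₂ (λ d m → if d then suc m else 0) (+-<ᵇ a) (length-map (a +_) w)) (rmaj-map-+ a (y ∷ w))
  where
  +-<ᵇ : ∀ a → (a + x <ᵇ a + y) ≡ (x <ᵇ y)
  +-<ᵇ zero    = refl
  +-<ᵇ (suc a) = +-<ᵇ a

-- For the reversal w of a permutation π of 0, …, n - 1: x precedes x + 1 in w exactly when
-- x + 1 precedes x in π, i.e. when π⁻¹ has a descent between x and x + 1. The term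
-- x = n - 1 vanishes as n does not occur in w.
imaj : ℕ → List ℕ → ℕ
imaj n w = ∑[ x ∈ upTo n ] (if does ((x ∷ suc x ∷ []) ⊆? w) then suc x else 0)

-- Inverse descents of shuffles

interleaving⇒⊆ : ∀ {u v z : List A} → Interleaving u v z → u ⊆ z
interleaving⇒⊆ []        = []
interleaving⇒⊆ (consˡ i) = refl ∷ interleaving⇒⊆ i
interleaving⇒⊆ (consʳ i) = _ ∷ʳ interleaving⇒⊆ i

-- A letter of `ws` matched at a place that comes from `v` would occur in `v`, so the whole match
-- lies in `u`.
⊆-interleaving⁻ : ∀ {u v z ws : List A} → Interleaving u v z → All (_∉ v) ws → ws ⊆ z → ws ⊆ u
⊆-interleaving⁻ []        _          []          = []
⊆-interleaving⁻ (consˡ i) ∉v         (x ∷ʳ s)    = x ∷ʳ ⊆-interleaving⁻ i ∉v s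
⊆-interleaving⁻ (consˡ i) (_ ∷ ∉v)   (refl ∷ s)  = refl ∷ ⊆-interleaving⁻ i ∉v s
⊆-interleaving⁻ (consʳ i) ∉v         (_ ∷ʳ s)    = ⊆-interleaving⁻ i (All.map (_∘ there) ∉v) s
⊆-interleaving⁻ (consʳ i) (x∉v ∷ _)  (refl ∷ s)  = ⊥-elim (x∉v (here refl))

⊆?-interleaving : ∀ {u v z ws} → Interleaving u v z → All (_∉ v) ws → does (ws ⊆? z) ≡ does (ws ⊆? u)
⊆?-interleaving {u} {v} {z} {ws} i ∉v =
  does-⇔ (mk⇔ (⊆-interleaving⁻ i ∉v) (λ s → ⊆-trans s (interleaving⇒⊆ i))) (ws ⊆? z) (ws ⊆? u)

-- Congruence modulo `m` is carried as an explicit multiple, the form that `Periodic-*` consumes.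
-- One sign is enough, since passing from a shuffle to its two words only removes multiples.
∑-≡-mod : ∀ (xs : List A) {f g} m → (∀ {x} → x ∈ xs → ∃[ c ] f x ≡ c * m + g x) → ∃[ c ] ∑ xs f ≡ c * m + ∑ xs g
∑-≡-mod []       m e = 0 , refl
∑-≡-mod (x ∷ xs) {f} {g} m e with e (here refl) | ∑-≡-mod xs m (e ∘ there)
... | c , p | d , q = c + d , trans (cong₂ _+_ p q) (rearrange c d m (g x) (∑ xs g))
  where
  rearrange : ∀ c d m p q → c * m + p + (d * m + q) ≡ (c + d) * m + (p + q)
  rearrange = solve-∀

-- The relative order of x and x + 1 in `z` is decided in `u` if both are below `a`, and in the
-- shifted `v` if both are at least `a`; in the latter case the weight exceeds that in `imaj b v` by
-- `a`. Only the pair a - 1, a straddles the two words, and its weight is `a` itself. Hence every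
-- correction is a multiple of `a`.
imaj-interleaving : ∀ a b {u v z} → All (_< a) u → Interleaving u (map (a +_) v) z →
  ∃[ c ] imaj (a + b) z ≡ c * a + (imaj a u + imaj b v)
imaj-interleaving a b {u} {v} {z} u<a i =
  let c , p = ∑-≡-mod (upTo a) a small
      d , q = ∑-≡-mod (upTo b) a large
  in c + d , trans (trans (cong (λ xs → ∑ xs (term z)) (upTo-+ a b))
                   (trans (∑-++ (upTo a) _) (cong₂ _+_ p (trans (∑-map (a +_) (upTo b)) q))))
                   (rearrange c d a _ _)
  where
  rearrange : ∀ c d m p q → c * m + p + (d * m + q) ≡ (c + d) * m + (p + q)
  rearrange = solve-∀
  term : List ℕ → ℕ → ℕ
  term w x = if does ((x ∷ suc x ∷ []) ⊆? w) then suc x else 0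
  ∉v : ∀ {x} → x < a → x ∉ map (a +_) v
  ∉v x<a x∈ with y , _ , refl ← ∈-map⁻ (a +_) x∈ = m+n≮m a y x<a
  ∉u : ∀ {x} → a ≤ x → x ∉ u
  ∉u a≤x x∈ = <⇒≱ (All.lookup u<a x∈) a≤x
  small : ∀ {x} → x ∈ upTo a → ∃[ c ] term z x ≡ c * a + term u x
  small {x} x∈ with m≤n⇒m<n∨m≡n (∈-upTo⁻ x∈)
  ... | inj₁ sx<a = 0 , cong (if_then suc x else 0) (⊆?-interleaving i (∉v (<⇒≤ sx<a) ∷ ∉v sx<a ∷ []))
  -- Here `suc x` equals `a`, which is no letter of `u`: the term for `u` is 0, and the term for `z`
  -- is 0 or `a`.
  ... | inj₂ refl rewrite dec-false ((x ∷ suc x ∷ []) ⊆? u) (λ s → ∉u ≤-refl (to∈ (Sublist.∷ˡ⁻ s)))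
      with does ((x ∷ suc x ∷ []) ⊆? z)
  ...   | true  = 1 , cong suc (sym (trans (+-identityʳ _) (+-identityʳ x)))
  ...   | false = 0 , refl
  shifted : ∀ x → does ((a + x ∷ suc (a + x) ∷ []) ⊆? z) ≡ does ((x ∷ suc x ∷ []) ⊆? v)
  shifted x = trans (⊆?-interleaving (Interleaving.swap i) (∉u (m≤m+n a x) ∷ ∉u (m≤n⇒m≤1+n (m≤m+n a x)) ∷ []))
    (does-⇔ (mk⇔ (λ s → Heterogeneous.map (+-cancelˡ-≡ a _ _) (Heterogeneous.map⁻ (a +_) (a +_) (subst (_⊆ map (a +_) v) (sym letters) s)))
                 (λ s → subst (_⊆ map (a +_) v) letters (Sublist.map⁺ (a +_) s)))
            (_ ⊆? map (a +_) v) (_ ⊆? v))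
    where
    letters : a + x ∷ a + suc x ∷ [] ≡ a + x ∷ suc (a + x) ∷ []
    letters = cong (λ y → a + x ∷ y ∷ []) (+-suc a x)
  large : ∀ {x} → x ∈ upTo b → ∃[ c ] term z (a + x) ≡ c * a + term v x
  large {x} x∈ rewrite shifted x with does ((x ∷ suc x ∷ []) ⊆? v)
  ... | true  = 1 , sym (trans (cong (_+ suc x) (+-identityʳ a)) (+-suc a x))
  ... | false = 0 , refl

-- For fixed `u` and `v` the value of `imaj` modulo `a` is the same on all their shuffles, so the
-- second argument of `f` can be frozen and the shuffle theorem applied to `rmaj` alone.
∑-arrangements-upTo-+ : ∀ a b {f : ℕ → ℕ → ℕ} → (∀ x → Periodic a (f x)) →
  ∑[ w ∈ arrangements (upTo (a + b)) ] f (rmaj w) (imaj (a + b) w) ≡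
  ∑[ u ∈ arrangements (upTo a) ] ∑[ v ∈ arrangements (upTo b) ]
    gauss a b (λ t → f (rmaj u + rmaj v + t) (imaj a u + imaj b v))
∑-arrangements-upTo-+ a b {f} per = begin
  (∑[ w ∈ arrangements (upTo (a + b)) ] F w)
    ≡⟨ cong (λ xs → ∑ (arrangements xs) F) (upTo-+ a b) ⟩
  (∑[ w ∈ arrangements (upTo a ++ map (a +_) (upTo b)) ] F w)
    ≡⟨ ∑-arrangements-++ (upTo a) _ ⟩
  (∑[ u ∈ arrangements (upTo a) ] ∑[ v ∈ arrangements (map (a +_) (upTo b)) ] ∑ (shuffles u v) F)
    ≡⟨ ∑-cong (arrangements (upTo a)) (λ u → ∑-arrangements-map (a +_) (upTo b)) ⟩
  (∑[ u ∈ arrangements (upTo a) ] ∑[ v ∈ arrangements (upTo b) ] ∑ (shuffles u (map (a +_) v)) F)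
    ≡⟨ ∑-cong-∈ (arrangements (upTo a)) (λ {u} u∈ → ∑-cong-∈ (arrangements (upTo b)) (λ {v} v∈ →
         split (∈-arrangements⁻ (upTo a) u∈) (∈-arrangements⁻ (upTo b) v∈))) ⟩
  (∑[ u ∈ arrangements (upTo a) ] ∑[ v ∈ arrangements (upTo b) ]
    gauss a b (λ t → f (rmaj u + rmaj v + t) (imaj a u + imaj b v))) ∎
  where
  open ≡-Reasoning
  F : List ℕ → ℕ
  F w = f (rmaj w) (imaj (a + b) w)
  split : ∀ {u v} → u ↭ upTo a → v ↭ upTo b → ∑ (shuffles u (map (a +_) v)) F ≡
    gauss a b (λ t → f (rmaj u + rmaj v + t) (imaj a u + imaj b v))
  split {u} {v} u↭ v↭ = begin
    (∑[ z ∈ shuffles u (map (a +_) v) ] f (rmaj z) (imaj (a + b) z))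
      ≡⟨ ∑-cong-∈ (shuffles u (map (a +_) v)) (λ {z} z∈ →
           let c , e = imaj-interleaving a b u<a (∈-shuffles⁻ u (map (a +_) v) z∈) in
           trans (cong (f (rmaj z)) e) (Periodic-* (per (rmaj z)) c _)) ⟩
    (∑[ z ∈ shuffles u (map (a +_) v) ] f (rmaj z) (imaj a u + imaj b v))
      ≡⟨ ∑-rmaj-shuffles u<a a≤v (λ m → f m (imaj a u + imaj b v)) ⟩
    gauss (length u) (length (map (a +_) v)) (λ t → f (rmaj u + rmaj (map (a +_) v) + t) (imaj a u + imaj b v))
      ≡⟨ cong₂ (λ k l → gauss k l (λ t → f (rmaj u + rmaj (map (a +_) v) + t) (imaj a u + imaj b v)))
           (trans (↭-length u↭) (length-upTo a))
           (trans (length-map (a +_) v) (trans (↭-length v↭) (length-upTo b))) ⟩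
    gauss a b (λ t → f (rmaj u + rmaj (map (a +_) v) + t) (imaj a u + imaj b v))
      ≡⟨ cong (λ m → gauss a b (λ t → f (rmaj u + m + t) (imaj a u + imaj b v))) (rmaj-map-+ a v) ⟩
    gauss a b (λ t → f (rmaj u + rmaj v + t) (imaj a u + imaj b v)) ∎
    where
    u<a : All (_< a) u
    u<a = All-resp-↭ (↭-sym u↭) (All.all-upTo a)
    a≤v : All (a ≤_) (map (a +_) v)
    a≤v = All.map⁺ (All.universal (m≤m+n a) v)

-- The symmetric group as arrangements

unique⇒↭ : ∀ {xs ys : List A} → Unique xs → Unique ys → (∀ {x} → x ∈ xs → x ∈ ys) → (∀ {x} → x ∈ ys → x ∈ xs) → xs ↭ ys
unique⇒↭ uxs uys to from = ∼bag⇒↭ (unique∧set⇒bag uxs uys (mk⇔ to from))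

Unique-concatMap : ∀ (g : A → List B) {xs} → Unique xs → All (Unique ∘ g) xs →
  (∀ {x y} → x ∈ xs → y ∈ xs → x ≢ y → Disjoint (g x) (g y)) → Unique (concatMap g xs)
Unique-concatMap g {xs} uxs ug disj = Unique.concat⁺ (All.map⁺ ug) (AllPairs.map⁺ (pairs uxs disj))
  where
  pairs : ∀ {xs} → Unique xs → (∀ {x y} → x ∈ xs → y ∈ xs → x ≢ y → Disjoint (g x) (g y)) →
    AllPairs (λ x y → Disjoint (g x) (g y)) xs
  pairs []       d = []
  pairs (x∉ ∷ u) d = All.tabulate (λ y∈ → d (here refl) (there y∈) (All.lookup x∉ y∈)) ∷ pairs u (λ p q → d (there p) (there q))

-- Injectivity is asked for on the members of the list because this is applied to `inverse`, which
-- is an involution on permutations but not on all words.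
Unique-map-∈ : ∀ (g : A → B) {xs} → (∀ {x y} → x ∈ xs → y ∈ xs → g x ≡ g y → x ≡ y) → Unique xs → Unique (map g xs)
Unique-map-∈ g inj []       = []
Unique-map-∈ g inj (x∉ ∷ u) = All.map⁺ (All.tabulate (λ y∈ e → All.lookup x∉ y∈ (inj (here refl) (there y∈) e)))
  ∷ Unique-map-∈ g (λ p q → inj (there p) (there q)) u

∈-shuffles-[x]⁺ : ∀ (x : A) u v → u ++ x ∷ v ∈ shuffles [ x ] (u ++ v)
∈-shuffles-[x]⁺ x []      []      = here refl
∈-shuffles-[x]⁺ x []      (y ∷ v) = here refl
∈-shuffles-[x]⁺ x (y ∷ u) v       = there (∈-map⁺ (y ∷_) (∈-shuffles-[x]⁺ x u v))

-- Deleting an occurrence of the head `x` from `w` leaves an arrangement of the tail, and inserting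
-- it again recovers `w`.
∈-arrangements⁺ : ∀ {xs w : List A} → w ↭ xs → w ∈ arrangements xs
∈-arrangements⁺ {xs = []}     {[]}    p = here refl
∈-arrangements⁺ {xs = []}     {x ∷ w} p with () ← ↭-length p
∈-arrangements⁺ {xs = x ∷ xs} {w} p with u , v , refl ← ∈-∃++ (∈-resp-↭ (↭-sym p) (here refl)) =
  ∈-concatMap⁺ (shuffles [ x ]) (lose (∈-arrangements⁺ {xs = xs} (drop-mid u [] p)) (∈-shuffles-[x]⁺ x u v))

Unique-shuffles-[x] : ∀ {x : A} w → x ∉ w → Unique (shuffles [ x ] w)
Unique-shuffles-[x] []      x∉ = [] ∷ []
Unique-shuffles-[x] {x = x} (y ∷ w) x∉ =
  All.map⁺ (All.tabulate (λ _ e → x∉ (here (∷-injectiveˡ e)))) ∷ Unique.map⁺ ∷-injectiveʳ (Unique-shuffles-[x] w (x∉ ∘ there))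

-- As `x` occurs in neither word, its place in `z` is determined and deleting it recovers the word.
-- This makes the insertions into different arrangements disjoint.
interleaving-[x]-injective : ∀ {x : A} {u v z} → x ∉ u → x ∉ v → Interleaving [ x ] u z → Interleaving [ x ] v z → u ≡ v
interleaving-[x]-injective x∉u x∉v (consˡ i) (consˡ j) = trans (sym (unit i)) (unit j)
  where
  unit : ∀ {u z : List A} → Interleaving [] u z → z ≡ u
  unit []        = refl
  unit (consʳ i) = cong (_ ∷_) (unit i)
interleaving-[x]-injective x∉u x∉v (consˡ i) (consʳ j) = ⊥-elim (x∉v (here refl))
interleaving-[x]-injective x∉u x∉v (consʳ i) (consˡ j) = ⊥-elim (x∉u (here refl))
interleaving-[x]-injective x∉u x∉v (consʳ i) (consʳ j) = cong (_ ∷_) (interleaving-[x]-injective (x∉u ∘ there) (x∉v ∘ there) i j)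

Unique-arrangements : ∀ {xs : List A} → Unique xs → Unique (arrangements xs)
Unique-arrangements []                     = [] ∷ []
Unique-arrangements {xs = x ∷ xs} u@(_ ∷ us) = Unique-concatMap (shuffles [ x ]) (Unique-arrangements us)
  (All.tabulate (λ {w} w∈ → Unique-shuffles-[x] w (x∉ w∈)))
  (λ {v} {w} v∈ w∈ v≢w (z∈v , z∈w) → v≢w (interleaving-[x]-injective (x∉ v∈) (x∉ w∈) (∈-shuffles⁻ [ x ] v z∈v) (∈-shuffles⁻ [ x ] w z∈w)))
  where
  x∉ : ∀ {w} → w ∈ arrangements xs → x ∉ w
  x∉ w∈ x∈ = Unique.Unique[x∷xs]⇒x∉xs u (∈-resp-↭ (∈-arrangements⁻ xs w∈) x∈)

Injective : ∀ {m} → Vec A m → Set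
Injective v = ∀ {p q} → lookup v p ≡ lookup v q → p ≡ q

-- Pigeonhole: if `x` were missed, punching it out of the codomain would leave an injection into a
-- smaller finite set.
injective⇒surjective : ∀ {v : Vec (Fin n) n} → Injective v → ∀ x → ∃[ p ] lookup v p ≡ x
injective⇒surjective {suc n} {v} inj x with Fin.any? (λ p → lookup v p Fin.≟ x)
... | yes found = found
... | no  none  = ⊥-elim (1+n≰n (Fin.injective⇒≤ {f = λ p → punchOut (x≢ p)}
  (λ e → inj (Fin.punchOut-injective (x≢ _) (x≢ _) e))))
  where
  x≢ : ∀ p → x ≢ lookup v p
  x≢ p e = none (p , sym e)

∈-toList : ∀ {m} (v : Vec A m) p → lookup v p ∈ toList v
∈-toList (a ∷ v) zero    = here refl
∈-toList (a ∷ v) (suc p) = there (∈-toList v p)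

∈-toList⁻ : ∀ {m} (v : Vec A m) {x} → x ∈ toList v → ∃[ p ] lookup v p ≡ x
∈-toList⁻ (a ∷ v) (here refl) = zero , refl
∈-toList⁻ (a ∷ v) (there x∈)  with p , e ← ∈-toList⁻ v x∈ = suc p , e

Unique⇒Injective : ∀ {m} (v : Vec A m) → Unique (toList v) → Injective v
Unique⇒Injective (a ∷ v) (a∉ ∷ u) {zero}  {zero}  e = refl
Unique⇒Injective (a ∷ v) (a∉ ∷ u) {zero}  {suc q} e = ⊥-elim (All.lookup a∉ (∈-toList v q) e)
Unique⇒Injective (a ∷ v) (a∉ ∷ u) {suc p} {zero}  e = ⊥-elim (All.lookup a∉ (∈-toList v p) (sym e))
Unique⇒Injective (a ∷ v) (a∉ ∷ u) {suc p} {suc q} e = cong suc (Unique⇒Injective v u e)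

Injective⇒Unique : ∀ {m} (v : Vec A m) → Injective v → Unique (toList v)
Injective⇒Unique []      inj = []
Injective⇒Unique (a ∷ v) inj = All.tabulate (λ x∈ e → distinct (∈-toList⁻ v x∈) e) ∷ Injective⇒Unique v (Fin.suc-injective ∘ inj)
  where
  distinct : ∀ {x} → ∃[ p ] lookup v p ≡ x → a ≢ x
  distinct (p , refl) e with () ← inj {zero} {suc p} e

∈-words : ∀ {m} (v : Vec (Fin n) m) → v ∈ words m n
∈-words []      = here refl
∈-words (a ∷ v) = ∈-concatMap⁺ (λ a → map (a ∷_) (words _ _)) (lose (∈-allFin a) (∈-map⁺ (a ∷_) (∈-words v)))

Unique-words : ∀ m n → Unique (words m n)
Unique-words zero    n = [] ∷ []
Unique-words (suc m) n = Unique-concatMap _ (Unique.allFin⁺ n)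
  (All.universal (λ a → Unique.map⁺ Vec.∷-injectiveʳ (Unique-words m n)) _)
  (λ {a} {b} _ _ a≢b (z∈a , z∈b) → disjoint a≢b (∈-map⁻ (a ∷_) z∈a) (∈-map⁻ (b ∷_) z∈b))
  where
  disjoint : ∀ {a b z} → a ≢ b → ∃[ v ] (v ∈ words m n × z ≡ a ∷ v) → ¬ (∃[ w ] (w ∈ words m n × z ≡ b ∷ w))
  disjoint a≢b (_ , _ , refl) (_ , _ , e) = a≢b (Vec.∷-injectiveˡ e)

∈-Sym⁺ : ∀ {v : Vec (Fin n) n} → Injective v → v ∈ Sym n
∈-Sym⁺ {v = v} inj = ∈-filter⁺ (λ v → unique? Fin._≟_ (toList v)) (∈-words v) (Injective⇒Unique v inj)

∈-Sym⁻ : ∀ {v : Vec (Fin n) n} → v ∈ Sym n → Injective v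
∈-Sym⁻ {n} {v} v∈ = Unique⇒Injective v (proj₂ (∈-filter⁻ (λ v → unique? Fin._≟_ (toList v)) {xs = words n n} v∈))

Unique-Sym : ∀ n → Unique (Sym n)
Unique-Sym n = Unique.filter⁺ _ (Unique-words n n)

injective⇒↭ : ∀ {v : Vec (Fin n) n} → Injective v → toList v ↭ allFin n
injective⇒↭ {n} {v} inj = unique⇒↭ (Injective⇒Unique v inj) (Unique.allFin⁺ n) (λ {x} _ → ∈-allFin x)
  (λ {x} _ → let p , e = injective⇒surjective {v = v} inj x in subst (_∈ toList v) e (∈-toList v p))

toList-surjective : ∀ {m} (w : List A) → length w ≡ m → ∃[ v ] toList {n = m} v ≡ w
toList-surjective w refl = Vec.fromList w , Vec.toList∘fromList w

-- Both lists are free of repetitions and have the same members. Words are reversed so that `maj` of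
-- the permutation becomes `rmaj` of the word.
Sym↭arrangements : ∀ n → map (reverse ∘ toList) (Sym n) ↭ arrangements (allFin n)
Sym↭arrangements n = unique⇒↭
  (Unique.map⁺ (λ {v} {w} e → trans (sym (Vec.cast-is-id refl v)) (Vec.toList-injective refl v w (reverse-injective e))) (Unique-Sym n))
  (Unique-arrangements (Unique.allFin⁺ n))
  to from
  where
  to : ∀ {w} → w ∈ map (reverse ∘ toList) (Sym n) → w ∈ arrangements (allFin n)
  to w∈ with v , v∈ , refl ← ∈-map⁻ (reverse ∘ toList) w∈ =
    ∈-arrangements⁺ (↭-trans (↭-reverse (toList v)) (injective⇒↭ (∈-Sym⁻ v∈)))
  from : ∀ {w} → w ∈ arrangements (allFin n) → w ∈ map (reverse ∘ toList) (Sym n)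
  from {w} w∈ with toList-surjective {m = n} (reverse w) (trans (↭-length (↭-trans (↭-reverse w) (∈-arrangements⁻ (allFin n) w∈))) (length-tabulate id))
  ... | v , e = subst (_∈ map (reverse ∘ toList) (Sym n)) (trans (cong reverse e) (reverse-involutive w))
    (∈-map⁺ (reverse ∘ toList) (∈-Sym⁺ {v = v} (Unique⇒Injective v (subst Unique (sym e)
      (Permutationₛ.Unique-resp-↭ (setoid (Fin n)) (↭⇒↭ₛ (↭-sym (↭-trans (↭-reverse w) (∈-arrangements⁻ (allFin n) w∈)))) (Unique.allFin⁺ n))))))

∑-Sym : ∀ n {f} → ∑[ π ∈ Sym n ] f (reverse (map toℕ (toList π))) ≡ ∑ (arrangements (upTo n)) f
∑-Sym n {f} = begin
  (∑[ π ∈ Sym n ] f (reverse (map toℕ (toList π))))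
    ≡⟨ ∑-cong (Sym n) (λ π → cong f (reverse-map toℕ (toList π))) ⟨
  (∑[ π ∈ Sym n ] f (map toℕ (reverse (toList π))))
    ≡⟨ ∑-map (reverse ∘ toList) (Sym n) ⟨
  (∑[ w ∈ map (reverse ∘ toList) (Sym n) ] f (map toℕ w))
    ≡⟨ ∑-↭ (Sym↭arrangements n) ⟩
  (∑[ w ∈ arrangements (allFin n) ] f (map toℕ w))
    ≡⟨ ∑-arrangements-map toℕ (allFin n) ⟨
  ∑ (arrangements (map toℕ (allFin n))) f
    ≡⟨ cong (λ xs → ∑ (arrangements xs) f) (trans (map-tabulate id toℕ) (tabulate-toℕ n id)) ⟩
  ∑ (arrangements (upTo n)) f ∎
  where
  open ≡-Reasoning
  tabulate-toℕ : ∀ n (g : ℕ → A) → List.tabulate {n = n} (g ∘ toℕ) ≡ applyUpTo g n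
  tabulate-toℕ zero    g = refl
  tabulate-toℕ (suc n) g = cong (g 0 ∷_) (tabulate-toℕ n (g ∘ suc))

-- The accumulator of the reversal holds the letters read so far, so its length is the position of
-- `a`, which is the counter of `majFrom`.
majFrom-ʳ++ : ∀ {m} (a : Fin n) (v : Vec (Fin n) m) w →
  rmaj (map toℕ (toList v) ʳ++ (toℕ a ∷ w)) ≡ majFrom (suc (length w)) (a ∷ v) + rmaj (toℕ a ∷ w)
majFrom-ʳ++ a []      w = refl
majFrom-ʳ++ a (b ∷ v) w = begin
  rmaj (map toℕ (toList v) ʳ++ (toℕ b ∷ toℕ a ∷ w))
    ≡⟨ majFrom-ʳ++ b v (toℕ a ∷ w) ⟩
  majFrom (suc (suc (length w))) (b ∷ v) + (d + rmaj (toℕ a ∷ w))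
    ≡⟨ +-assoc (majFrom (suc (suc (length w))) (b ∷ v)) d _ ⟨
  majFrom (suc (suc (length w))) (b ∷ v) + d + rmaj (toℕ a ∷ w)
    ≡⟨ cong (_+ rmaj (toℕ a ∷ w)) (+-comm (majFrom (suc (suc (length w))) (b ∷ v)) d) ⟩
  d + majFrom (suc (suc (length w))) (b ∷ v) + rmaj (toℕ a ∷ w) ∎
  where
  open ≡-Reasoning
  d = if toℕ b <ᵇ toℕ a then suc (length w) else 0

maj≡rmaj : ∀ {m} (v : Vec (Fin n) m) → maj v ≡ rmaj (reverse (map toℕ (toList v)))
maj≡rmaj []      = refl
maj≡rmaj (a ∷ v) = sym (trans (majFrom-ʳ++ a v []) (+-identityʳ _))

-- Exposes the tabulated function of inverse, which is local to its definition.
inverse-tabulate : (v : Vec (Fin n) n) → Σ (Fin n → Fin n) (λ g → inverse v ≡ tabulate g)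
inverse-tabulate v = _ , refl

positionOf-lookup : ∀ {m} (v : Vec (Fin n) m) → Injective v → ∀ p → positionOf (lookup v p) v ≡ just p
positionOf-lookup (a ∷ v) inj zero rewrite dec-true (a Fin.≟ a) refl = refl
positionOf-lookup (a ∷ v) inj (suc p)
  rewrite dec-false (a Fin.≟ lookup v p) (λ e → Fin.0≢1+n (inj {zero} {suc p} e))
        | positionOf-lookup v (Fin.suc-injective ∘ inj) p = refl

inverseˡ : ∀ {v : Vec (Fin n) n} → Injective v → ∀ p → lookup (inverse v) (lookup v p) ≡ p
inverseˡ {v = v} inj p = trans (Vec.lookup∘tabulate (proj₁ (inverse-tabulate v)) (lookup v p)) position
  where
  position : proj₁ (inverse-tabulate v) (lookup v p) ≡ p
  position rewrite positionOf-lookup v inj p = refl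

inverseʳ : ∀ {v : Vec (Fin n) n} → Injective v → ∀ x → lookup v (lookup (inverse v) x) ≡ x
inverseʳ {v = v} inj x with p , refl ← injective⇒surjective {v = v} inj x = cong (lookup v) (inverseˡ {v = v} inj p)

inverse-injective : ∀ {v : Vec (Fin n) n} → Injective v → Injective (inverse v)
inverse-injective {v = v} inj {x} {y} e =
  trans (sym (inverseʳ {v = v} inj x)) (trans (cong (lookup v) e) (inverseʳ {v = v} inj y))

inverse-involutive : ∀ {v : Vec (Fin n) n} → Injective v → inverse (inverse v) ≡ v
inverse-involutive {v = v} inj = lookup-ext (λ x → begin
  lookup (inverse (inverse v)) x                                  ≡⟨ cong (lookup (inverse (inverse v))) (inverseˡ {v = v} inj x) ⟨
  lookup (inverse (inverse v)) (lookup (inverse v) (lookup v x))  ≡⟨ inverseˡ {v = inverse v} (inverse-injective {v = v} inj) (lookup v x) ⟩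
  lookup v x                                                      ∎)
  where
  open ≡-Reasoning
  lookup-ext : ∀ {m} {u w : Vec A m} → (∀ x → lookup u x ≡ lookup w x) → u ≡ w
  lookup-ext {u = u} {w} e = trans (sym (Vec.tabulate∘lookup u)) (trans (Vec.tabulate-cong e) (Vec.tabulate∘lookup w))

inverse-Sym : ∀ n → map inverse (Sym n) ↭ Sym n
inverse-Sym n = unique⇒↭
  (Unique-map-∈ inverse (λ {u} {v} u∈ v∈ e → trans (sym (invol u∈)) (trans (cong inverse e) (invol v∈))) (Unique-Sym n))
  (Unique-Sym n)
  (λ w∈ → closed (∈-map⁻ inverse w∈))
  (λ {v} v∈ → subst (_∈ map inverse (Sym n)) (invol v∈) (∈-map⁺ inverse (closed (v , v∈ , refl))))
  where
  invol : ∀ {v} → v ∈ Sym n → inverse (inverse v) ≡ v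
  invol {v} v∈ = inverse-involutive {v = v} (∈-Sym⁻ v∈)
  closed : ∀ {w} → ∃[ v ] (v ∈ Sym n × w ≡ inverse v) → w ∈ Sym n
  closed (v , v∈ , refl) = ∈-Sym⁺ (inverse-injective {v = v} (∈-Sym⁻ v∈))

⊆-toList⁺ : ∀ {m} (v : Vec A m) {q p} → q Fin.< p → (lookup v q ∷ lookup v p ∷ []) ⊆ toList v
⊆-toList⁺ (a ∷ v) {zero}  {suc p} _         = refl ∷ from∈ (∈-toList v p)
⊆-toList⁺ (a ∷ v) {suc q} {suc p} (s<s q<p) = a ∷ʳ ⊆-toList⁺ v q<p

⊆-toList⁻ : ∀ {m} (v : Vec A m) {x y} → (y ∷ x ∷ []) ⊆ toList v →
  ∃[ q ] ∃[ p ] (q Fin.< p × lookup v q ≡ y × lookup v p ≡ x)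
⊆-toList⁻ (a ∷ v) (refl ∷ s) with p , e ← ∈-toList⁻ v (to∈ s) = zero , suc p , z<s , refl , e
⊆-toList⁻ (a ∷ v) (_ ∷ʳ s) with q , p , q<p , e , e' ← ⊆-toList⁻ v s = suc q , suc p , s<s q<p , e , e'

-- A nonempty word of length `m` has m - 1 adjacent pairs, whereas the sum, like that in `imaj`, has
-- `m` terms; the last one is therefore required to vanish. The offset `s` lets the induction pass
-- to the tail.
majFrom≡∑ : ∀ {m} s (u : Vec (Fin n) m) (h : ℕ → ℕ) →
  (∀ {j j'} → toℕ j' ≡ suc (toℕ j) → h (toℕ j) ≡ (if toℕ (lookup u j') <ᵇ toℕ (lookup u j) then suc (s + toℕ j) else 0)) →
  (∀ {j} → suc j ≡ m → h j ≡ 0) →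
  majFrom (suc s) u ≡ ∑ (upTo m) h
majFrom≡∑ s []          h desc last = refl
majFrom≡∑ s (a ∷ [])    h desc last = sym (trans (+-identityʳ _) (last refl))
majFrom≡∑ {m = suc m} s (a ∷ b ∷ u) h desc last = sym (trans (∑-upTo-suc m h)
  (cong₂ _+_ (trans (desc {zero} {suc zero} refl) (cong (λ i → if toℕ b <ᵇ toℕ a then suc i else 0) (+-identityʳ s)))
    (sym (majFrom≡∑ (suc s) (b ∷ u) (h ∘ suc)
      (λ {j} {j'} e → trans (desc {suc j} {suc j'} (cong suc e))
        (cong (λ i → if toℕ (lookup (b ∷ u) j') <ᵇ toℕ (lookup (b ∷ u) j) then suc i else 0) (+-suc s (toℕ j))))
      (λ e → last (cong suc e))))))

maj-inverse : ∀ {v : Vec (Fin n) n} → Injective v → maj (inverse v) ≡ imaj n (reverse (map toℕ (toList v)))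
maj-inverse {n} {v} inj = majFrom≡∑ 0 (inverse v) _
  (λ {j} {j'} e → cong (if_then suc (toℕ j) else 0) (subst (λ y → does ((toℕ j ∷ y ∷ []) ⊆? w) ≡ (toℕ (lookup (inverse v) j') <ᵇ toℕ (lookup (inverse v) j))) e (descent j j')))
  (λ {j} e → cong (if_then suc j else 0) (dec-false ((j ∷ suc j ∷ []) ⊆? w)
    (λ s → absent e (∈-resp-↭ (↭-reverse (map toℕ (toList v))) (to∈ (Sublist.∷ˡ⁻ s))))))
  where
  w = reverse (map toℕ (toList v))
  absent : ∀ {j} → j ≡ n → j ∉ map toℕ (toList v)
  absent refl j∈ with x , _ , e ← ∈-map⁻ toℕ j∈ = <-irrefl (sym e) (Fin.toℕ<n x)
  descent : ∀ j j' → does ((toℕ j ∷ toℕ j' ∷ []) ⊆? w) ≡ (toℕ (lookup (inverse v) j') <ᵇ toℕ (lookup (inverse v) j))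
  descent j j' = does-⇔ (mk⇔ to from) (_ ⊆? w) (toℕ (lookup (inverse v) j') <? toℕ (lookup (inverse v) j))
    where
    to : (toℕ j ∷ toℕ j' ∷ []) ⊆ w → lookup (inverse v) j' Fin.< lookup (inverse v) j
    to s with q , p , q<p , refl , refl ← ⊆-toList⁻ v (Heterogeneous.map Fin.toℕ-injective
                (Heterogeneous.map⁻ {as = j' ∷ j ∷ []} toℕ toℕ (Sublist.reverse⁻ {as = toℕ j' ∷ toℕ j ∷ []} s)))
      = subst₂ Fin._<_ (sym (inverseˡ {v = v} inj q)) (sym (inverseˡ {v = v} inj p)) q<p
    from : lookup (inverse v) j' Fin.< lookup (inverse v) j → (toℕ j ∷ toℕ j' ∷ []) ⊆ w
    from q<p = Sublist.reverse⁺ (Sublist.map⁺ toℕ (subst₂ (λ y x → (y ∷ x ∷ []) ⊆ toList v)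
      (inverseʳ {v = v} inj j') (inverseʳ {v = v} inj j) (⊆-toList⁺ v q<p)))

-- Joint distribution of maj π and maj π⁻¹

majSum : ℕ → (ℕ → ℕ → ℕ) → ℕ
majSum n f = ∑[ π ∈ Sym n ] f (maj π) (maj (inverse π))

majSum-cong : ∀ n {f g : ℕ → ℕ → ℕ} → (∀ x y → f x y ≡ g x y) → majSum n f ≡ majSum n g
majSum-cong n e = ∑-cong (Sym n) (λ π → e _ _)

majSum≡∑-arrangements : ∀ n f → majSum n f ≡ ∑[ w ∈ arrangements (upTo n) ] f (rmaj w) (imaj n w)
majSum≡∑-arrangements n f = trans
  (∑-cong-∈ (Sym n) (λ {π} π∈ → cong₂ f (maj≡rmaj π) (maj-inverse {v = π} (∈-Sym⁻ π∈))))
  (∑-Sym n {λ w → f (rmaj w) (imaj n w)})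

-- The substitution of π⁻¹ for π permutes the symmetric group and exchanges the two statistics.
majSum-flip : ∀ n f → majSum n f ≡ majSum n (flip f)
majSum-flip n f = begin
  majSum n f
    ≡⟨ ∑-↭ (inverse-Sym n) ⟨
  (∑[ π ∈ map inverse (Sym n) ] f (maj π) (maj (inverse π)))
    ≡⟨ ∑-map inverse (Sym n) ⟩
  (∑[ π ∈ Sym n ] f (maj (inverse π)) (maj (inverse (inverse π))))
    ≡⟨ ∑-cong-∈ (Sym n) (λ {π} π∈ → cong (λ ρ → f (maj (inverse π)) (maj ρ)) (inverse-involutive {v = π} (∈-Sym⁻ π∈))) ⟩
  majSum n (flip f) ∎
  where open ≡-Reasoning

-- Nesting functionals while adding their arguments is multiplication of polynomials, so this is
-- A_{a+b} = [a + b choose a]_p A_a A_b modulo q^a - 1.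
majSum-+ : ∀ a b {f : ℕ → ℕ → ℕ} → (∀ x → Periodic a (f x)) →
  majSum (a + b) f ≡ majSum a (λ x x' → majSum b (λ y y' → gauss a b (λ t → f (x + y + t) (x' + y'))))
majSum-+ a b {f} per = begin
  majSum (a + b) f
    ≡⟨ majSum≡∑-arrangements (a + b) f ⟩
  (∑[ w ∈ arrangements (upTo (a + b)) ] f (rmaj w) (imaj (a + b) w))
    ≡⟨ ∑-arrangements-upTo-+ a b per ⟩
  (∑[ u ∈ arrangements (upTo a) ] ∑[ v ∈ arrangements (upTo b) ] g (rmaj u) (imaj a u) (rmaj v) (imaj b v))
    ≡⟨ ∑-cong (arrangements (upTo a)) (λ u → majSum≡∑-arrangements b (g (rmaj u) (imaj a u))) ⟨
  (∑[ u ∈ arrangements (upTo a) ] majSum b (g (rmaj u) (imaj a u)))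
    ≡⟨ majSum≡∑-arrangements a (λ x x' → majSum b (g x x')) ⟨
  majSum a (λ x x' → majSum b (g x x')) ∎
  where
  open ≡-Reasoning
  g : ℕ → ℕ → ℕ → ℕ → ℕ
  g x x' y y' = gauss a b (λ t → f (x + y + t) (x' + y'))

-- Splitting the k letters as 1 + (k - 1) brings out the factor [k choose 1]_p, which absorbs the
-- shift because 1 is coprime to k. The test function ignores maj π⁻¹ and so has period 1 in it, as
-- the splitting demands.
majSum-maj-shift : ∀ k .{{_ : NonZero k}} {h : ℕ → ℕ} → Periodic k h → majSum k (λ x _ → h (suc x)) ≡ majSum k (λ x _ → h x)
majSum-maj-shift (suc k) {h} per = begin
  majSum (1 + k) (λ x _ → h (suc x))
    ≡⟨ majSum-+ 1 k {λ x _ → h (suc x)} (λ _ _ → refl) ⟩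
  majSum 1 (λ x _ → majSum k (λ y _ → gauss 1 k (λ t → h (suc (x + y + t)))))
    ≡⟨ majSum-cong 1 (λ x _ → majSum-cong k (λ y _ → trans
         (gauss-cong 1 k (λ t → cong h (sym (+-suc (x + y) t))))
         (gauss-shift 1 k (Coprimality.1-coprimeTo (1 + k)) (λ t → trans (cong h (exponent k (x + y) t)) (per _))))) ⟩
  majSum 1 (λ x _ → majSum k (λ y _ → gauss 1 k (λ t → h (x + y + t))))
    ≡⟨ majSum-+ 1 k {λ x _ → h x} (λ _ _ → refl) ⟨
  majSum (1 + k) (λ x _ → h x) ∎
  where
  open ≡-Reasoning
  exponent : ∀ k d t → d + (suc k + t) ≡ suc k + (d + t)
  exponent = solve-∀

-- Shift invariance for coprime periods

ShiftInvariant : ℕ → (ℕ → ℕ → ℕ) → Set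
ShiftInvariant n f = majSum n (λ x y → f (suc x) y) ≡ majSum n f × majSum n (λ x y → f x (suc y)) ≡ majSum n f

module _ (k m : ℕ) .{{_ : NonZero k}} (cop : Coprime k (k + m)) where

  -- This is the case n = l, with l = k + m. The flip in `factor` puts the argument of period k in
  -- second place, where `majSum-+` needs it. A shift of the second argument of `f` is then absorbed
  -- by [k + m choose k]_q. A shift of the first argument passes to the k-periodic function `H` and
  -- is absorbed by the uniformity of maj modulo k on permutations of k letters.
  shiftInvariant-base : ∀ {f : ℕ → ℕ → ℕ} → (∀ y → Periodic k (λ x → f x y)) → (∀ x → Periodic (k + m) (f x)) →
    ShiftInvariant (k + m) f
  shiftInvariant-base {f} per₁ per₂ = invariant₁ , invariant₂
    where
    open ≡-Reasoning
    G : ℕ → ℕ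
    G z = gauss k m (f z)
    H : ℕ → ℕ
    H x = majSum m (λ _ y → G (x + y))
    -- The Gaussian factor already averages the second argument over all residues.
    factor : ∀ {g : ℕ → ℕ → ℕ} → (∀ y → Periodic k (λ x → g x y)) → (∀ x → Periodic (k + m) (g x)) →
      majSum (k + m) g ≡ majSum k (λ _ x → majSum m (λ _ y → gauss k m (g (x + y))))
    factor {g} p₁ p₂ = begin
      majSum (k + m) g         ≡⟨ majSum-flip (k + m) g ⟩
      majSum (k + m) (flip g)  ≡⟨ majSum-+ k m p₁ ⟩
      majSum k (λ x x' → majSum m (λ y y' → gauss k m (λ t → g (x' + y') (x + y + t))))
        ≡⟨ majSum-cong k (λ x x' → majSum-cong m (λ y y' → gauss-shift-+ k m cop (p₂ (x' + y')) (x + y))) ⟩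
      majSum k (λ _ x' → majSum m (λ _ y' → gauss k m (g (x' + y')))) ∎
    H-periodic : Periodic k H
    H-periodic x = majSum-cong m (λ _ y → gauss-cong k m (λ t → trans (cong (λ z → f z t) (+-assoc k x y)) (per₁ t (x + y))))
    invariant₁ : majSum (k + m) (λ x y → f (suc x) y) ≡ majSum (k + m) f
    invariant₁ = begin
      majSum (k + m) (λ x y → f (suc x) y)
        ≡⟨ factor (λ y x → trans (cong (λ z → f z y) (sym (+-suc k x))) (per₁ y (suc x))) (λ x → per₂ (suc x)) ⟩
      majSum k (λ _ x → H (suc x))  ≡⟨ majSum-flip k (λ _ x → H (suc x)) ⟩
      majSum k (λ x _ → H (suc x))  ≡⟨ majSum-maj-shift k H-periodic ⟩
      majSum k (λ x _ → H x)        ≡⟨ majSum-flip k (λ _ x → H x) ⟨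
      majSum k (λ _ x → H x)        ≡⟨ factor per₁ per₂ ⟨
      majSum (k + m) f              ∎
    invariant₂ : majSum (k + m) (λ x y → f x (suc y)) ≡ majSum (k + m) f
    invariant₂ = begin
      majSum (k + m) (λ x y → f x (suc y))
        ≡⟨ factor (λ y → per₁ (suc y)) (λ x y → trans (cong (f x) (sym (+-suc (k + m) y))) (per₂ x (suc y))) ⟩
      majSum k (λ _ x → majSum m (λ _ y → gauss k m (f (x + y) ∘ suc)))
        ≡⟨ majSum-cong k (λ _ x → majSum-cong m (λ _ y → gauss-shift k m cop (per₂ (x + y)))) ⟩
      majSum k (λ _ x → H x)        ≡⟨ factor per₁ per₂ ⟨
      majSum (k + m) f              ∎

  -- Working modulo q^l - 1 with l = k + m, the remaining `r` letters and the Gaussian factor are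
  -- summed into a new test function `F` for permutations of l letters. It inherits both periods,
  -- and shifting an argument of `f` shifts the same argument of `F` definitionally.
  shiftInvariant-+ : ∀ r {f : ℕ → ℕ → ℕ} → (∀ y → Periodic k (λ x → f x y)) → (∀ x → Periodic (k + m) (f x)) →
    ShiftInvariant (k + m + r) f
  shiftInvariant-+ r {f} per₁ per₂ =
    trans (majSum-+ (k + m) r (λ x → per₂ (suc x))) (trans (proj₁ base) (sym (majSum-+ (k + m) r per₂))) ,
    trans (majSum-+ (k + m) r (λ x y → trans (cong (f x) (sym (+-suc (k + m) y))) (per₂ x (suc y))))
      (trans (proj₂ base) (sym (majSum-+ (k + m) r per₂)))
    where
    F : ℕ → ℕ → ℕ
    F x x' = majSum r (λ y y' → gauss (k + m) r (λ t → f (x + y + t) (x' + y')))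
    base : ShiftInvariant (k + m) F
    base = shiftInvariant-base
      (λ x' x → majSum-cong r (λ y y' → gauss-cong (k + m) r (λ t →
        trans (cong (λ z → f z (x' + y')) (assoc k x y t)) (per₁ (x' + y') (x + y + t)))))
      (λ x x' → majSum-cong r (λ y y' → gauss-cong (k + m) r (λ t →
        trans (cong (f (x + y + t)) (+-assoc (k + m) x' y')) (per₂ (x + y + t) (x' + y')))))
      where
      assoc : ∀ k x y t → k + x + y + t ≡ k + (x + y + t)
      assoc = solve-∀

shiftInvariant-< : ∀ {n k l} .{{_ : NonZero k}} → Coprime k l → k < l → l ≤ n →
  ∀ {f : ℕ → ℕ → ℕ} → (∀ y → Periodic k (λ x → f x y)) → (∀ x → Periodic l (f x)) → ShiftInvariant n f
shiftInvariant-< {n} {k} cop k<l l≤n with m≤n⇒∃[o]m+o≡n (<⇒≤ k<l)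
... | m , refl with m≤n⇒∃[o]m+o≡n l≤n
... | r , refl = shiftInvariant-+ k m cop r

shiftInvariant : ∀ {n k l} .{{_ : NonZero k}} .{{_ : NonZero l}} → Coprime k l → k ≤ n → l ≤ n →
  ∀ {f : ℕ → ℕ → ℕ} → (∀ y → Periodic k (λ x → f x y)) → (∀ x → Periodic l (f x)) → ShiftInvariant n f
shiftInvariant {n} {k} {l} cop k≤n l≤n {f} per₁ per₂ with <-cmp k l
... | tri< k<l _ _ = shiftInvariant-< cop k<l l≤n per₁ per₂
... | tri> _ _ l<k =
  let inv₁ , inv₂ = shiftInvariant-< (Coprimality.sym cop) l<k k≤n {flip f} per₂ per₁ in
  trans (majSum-flip n (λ x y → f (suc x) y)) (trans inv₂ (sym (majSum-flip n f))) ,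
  trans (majSum-flip n (λ x y → f x (suc y))) (trans inv₁ (sym (majSum-flip n f)))
-- Equal coprime moduli are both 1, and then periodicity is already invariance under unit shifts.
... | tri≈ _ refl _ with refl ← cop (∣-refl , ∣-refl) = majSum-cong n (λ x y → per₁ y x) , majSum-cong n (λ x y → per₂ x y)

shiftInvariant-* : ∀ {n k l} .{{_ : NonZero k}} .{{_ : NonZero l}} → Coprime k l → k ≤ n → l ≤ n →
  ∀ {f : ℕ → ℕ → ℕ} → (∀ y → Periodic k (λ x → f x y)) → (∀ x → Periodic l (f x)) →
  ∀ a b → majSum n (λ x y → f (a + x) (b + y)) ≡ majSum n f
shiftInvariant-* cop k≤n l≤n per₁ per₂ zero zero = refl
shiftInvariant-* {n} {k} {l} cop k≤n l≤n {f} per₁ per₂ zero (suc b) = trans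
  (shiftInvariant-* cop k≤n l≤n {λ x y → f x (suc y)} (λ y → per₁ (suc y))
    (λ x y → trans (cong (f x) (sym (+-suc l y))) (per₂ x (suc y))) zero b)
  (proj₂ (shiftInvariant cop k≤n l≤n per₁ per₂))
shiftInvariant-* {n} {k} {l} cop k≤n l≤n {f} per₁ per₂ (suc a) b = trans
  (shiftInvariant-* cop k≤n l≤n {λ x y → f (suc x) y}
    (λ y x → trans (cong (λ z → f z y) (sym (+-suc k x))) (per₁ y (suc x))) (λ x → per₂ (suc x)) a b)
  (proj₁ (shiftInvariant cop k≤n l≤n per₁ per₂))

-- Averaging over residue classes

𝟙 : Bool → ℕ
𝟙 b = if b then 1 else 0

𝟙-∧ : ∀ b c → 𝟙 (b ∧ c) ≡ 𝟙 b * 𝟙 c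
𝟙-∧ false c = refl
𝟙-∧ true  c = sym (+-identityʳ _)

length-filter : ∀ {p : Level} {P : Pred A p} (P? : Decidable P) xs → length (filter P? xs) ≡ ∑[ x ∈ xs ] 𝟙 (does (P? x))
length-filter P? []       = refl
length-filter P? (x ∷ xs) with does (P? x)
... | true  = cong suc (length-filter P? xs)
... | false = length-filter P? xs

-- Adding h 0 = h k to either side gives the sum over `upTo (1 + k)`.
∑-upTo-shift : ∀ k {h : ℕ → ℕ} → Periodic k h → ∑[ a ∈ upTo k ] h (suc a) ≡ ∑ (upTo k) h
∑-upTo-shift k {h} per = +-cancelˡ-≡ (h 0) _ _ (begin
  h 0 + (∑[ a ∈ upTo k ] h (suc a))  ≡⟨ ∑-upTo-suc k h ⟨
  ∑ (upTo (1 + k)) h                 ≡⟨ cong (λ n → ∑ (upTo n) h) (+-comm 1 k) ⟩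
  ∑ (upTo (k + 1)) h                 ≡⟨ cong (λ xs → ∑ xs h) (upTo-+ k 1) ⟩
  ∑ (upTo k ++ [ k + 0 ]) h          ≡⟨ ∑-++ (upTo k) [ k + 0 ] ⟩
  ∑ (upTo k) h + (h (k + 0) + 0)     ≡⟨ cong (∑ (upTo k) h +_) (trans (+-identityʳ _) (per 0)) ⟩
  ∑ (upTo k) h + h 0                 ≡⟨ +-comm (∑ (upTo k) h) (h 0) ⟩
  h 0 + ∑ (upTo k) h                 ∎)
  where open ≡-Reasoning

∑-window : ∀ k {h : ℕ → ℕ} → Periodic k h → ∀ x → ∑[ a ∈ upTo k ] h (a + x) ≡ ∑ (upTo k) h
∑-window k {h} per zero    = ∑-cong (upTo k) (λ a → cong h (+-identityʳ a))
∑-window k {h} per (suc x) = trans (∑-cong (upTo k) (λ a → cong h (+-suc a x)))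
  (trans (∑-window k (λ y → trans (cong h (sym (+-suc k y))) (per (suc y))) x) (∑-upTo-shift k per))

∑-𝟙-≡ᵇ : ∀ k {r} → r < k → ∑[ a ∈ upTo k ] 𝟙 (a ≡ᵇ r) ≡ 1
∑-𝟙-≡ᵇ (suc k) {zero}  _         = trans (∑-upTo-suc k (λ a → 𝟙 (a ≡ᵇ 0))) (cong suc (∑-0 (upTo k)))
∑-𝟙-≡ᵇ (suc k) {suc r} (s<s r<k) = trans (∑-upTo-suc k (λ a → 𝟙 (a ≡ᵇ suc r))) (∑-𝟙-≡ᵇ k r<k)

residue : ∀ k .{{_ : NonZero k}} → ℕ → ℕ → ℕ
residue k i x = 𝟙 ((x % k) ≡ᵇ (i % k))

residue-periodic : ∀ k .{{_ : NonZero k}} i → Periodic k (residue k i)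
residue-periodic k i x = cong (λ m → 𝟙 (m ≡ᵇ (i % k))) (trans (cong (_% k) (+-comm k x)) ([m+n]%n≡m%n x k))

∑-residue : ∀ k .{{_ : NonZero k}} i x → ∑[ a ∈ upTo k ] residue k i (a + x) ≡ 1
∑-residue k i x = begin
  (∑[ a ∈ upTo k ] residue k i (a + x))  ≡⟨ ∑-window k (residue-periodic k i) x ⟩
  (∑[ a ∈ upTo k ] residue k i a)        ≡⟨ ∑-cong-∈ (upTo k) (λ a∈ → cong (λ m → 𝟙 (m ≡ᵇ (i % k))) (m<n⇒m%n≡m (∈-upTo⁻ a∈))) ⟩
  (∑[ a ∈ upTo k ] 𝟙 (a ≡ᵇ (i % k)))     ≡⟨ ∑-𝟙-≡ᵇ k (m%n<n i k) ⟩
  1                                      ∎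
  where open ≡-Reasoning

majSum-const-1 : ∀ n → majSum n (λ _ _ → 1) ≡ n !
majSum-const-1 n = begin
  majSum n (λ _ _ → 1)                ≡⟨ majSum≡∑-arrangements n (λ _ _ → 1) ⟩
  (∑[ w ∈ arrangements (upTo n) ] 1)  ≡⟨ ∑-arrangements-const (upTo n) 1 ⟩
  length (upTo n) ! * 1               ≡⟨ *-identityʳ _ ⟩
  length (upTo n) !                   ≡⟨ cong _! (length-upTo n) ⟩
  n !                                 ∎
  where open ≡-Reasoning

theorem1p1 : (n k l i j : ℕ) → .{{_ : NonZero n}} → .{{_ : NonZero k}} → .{{_ : NonZero l}} →
    gcd k l ≡ 1 → k ≤ n → l ≤ n →
    k * l * count n k l i j ≡ n !
theorem1p1 n k l i j gcd≡1 k≤n l≤n = begin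
  k * l * count n k l i j
    -- The decision filtered by in `count` reduces to a conjunction of two `≡ᵇ` tests, so its
    -- indicator is the product `f` of two residue indicators.
    ≡⟨ cong (k * l *_) (trans (length-filter _ (Sym n)) (∑-cong (Sym n) (λ π → 𝟙-∧ ((maj π % k) ≡ᵇ (i % k)) _))) ⟩
  k * l * majSum n f
    ≡⟨ *-assoc k l (majSum n f) ⟩
  k * (l * majSum n f)
    ≡⟨ cong₂ (λ k' l' → k' * (l' * majSum n f)) (length-upTo k) (length-upTo l) ⟨
  length (upTo k) * (length (upTo l) * majSum n f)
    ≡⟨ trans (∑-cong (upTo k) (λ _ → ∑-const (upTo l) (majSum n f))) (∑-const (upTo k) _) ⟨
  (∑[ a ∈ upTo k ] ∑[ b ∈ upTo l ] majSum n f)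
    -- The k l equal copies are replaced by the k l shifts of `f`, which all have the same `majSum`.
    -- For each π exactly one of these shifts takes the value 1, so they add up to the constant 1
    -- (`total`).
    ≡⟨ ∑-cong (upTo k) (λ a → ∑-cong (upTo l) (λ b → sym
         (shiftInvariant-* (gcd≡1⇒coprime gcd≡1) k≤n l≤n periodic₁ periodic₂ a b))) ⟩
  (∑[ a ∈ upTo k ] ∑[ b ∈ upTo l ] majSum n (λ x y → f (a + x) (b + y)))
    ≡⟨ trans (∑-cong (upTo k) (λ a → ∑-swap (upTo l) (Sym n))) (∑-swap (upTo k) (Sym n)) ⟩
  majSum n (λ x y → ∑[ a ∈ upTo k ] ∑[ b ∈ upTo l ] f (a + x) (b + y))
    ≡⟨ majSum-cong n total ⟩
  majSum n (λ _ _ → 1)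
    ≡⟨ majSum-const-1 n ⟩
  n ! ∎
  where
  open ≡-Reasoning
  f : ℕ → ℕ → ℕ
  f x y = residue k i x * residue l j y
  periodic₁ : ∀ y → Periodic k (λ x → f x y)
  periodic₁ y x = cong (_* residue l j y) (residue-periodic k i x)
  periodic₂ : ∀ x → Periodic l (f x)
  periodic₂ x y = cong (residue k i x *_) (residue-periodic l j y)
  total : ∀ x y → ∑[ a ∈ upTo k ] ∑[ b ∈ upTo l ] f (a + x) (b + y) ≡ 1
  total x y = begin
    (∑[ a ∈ upTo k ] ∑[ b ∈ upTo l ] (residue k i (a + x) * residue l j (b + y)))
      ≡⟨ ∑-cong (upTo k) (λ a → trans (∑-*ˡ (upTo l) (residue k i (a + x)))
           (trans (cong (residue k i (a + x) *_) (∑-residue l j y)) (*-identityʳ _))) ⟩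
    (∑[ a ∈ upTo k ] residue k i (a + x))
      ≡⟨ ∑-residue k i x ⟩
    1 ∎
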